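{- Fix a tuple $\mu=(\mu_1,\ldots,\mu_n)$ of positive integers with sum $d$. Then \[ H_{g;\mu}\sim \frac{2}{d!\,\mu_1\cdots\mu_n}\binom{d}{2}^{d+2g-2+n}\qquad\text{as } g\to\infty . \]
   Context: For an integer $g$ and a tuple $\mu=(\mu_1,\ldots,\mu_n)$ of positive integers, the Hurwitz number $H_{g;\mu}$ is the weighted count of genus $g$ connected branched covers $f:\Sigma\to\mathbb{CP}^1$ with ramification profile $\mu$ over $\infty$, simple ramification over $|\mu|+2g-2+n$ fixed prescribed points of $\mathbb{CP}^1$, and no other branching; the preimages of $\infty$ are labelled $1,\ldots,n$ so that the point labelled $i$ has ramification index $\mu_i$. Isomorphisms are Riemann surface isomorphisms $\phi$ with $f=\tilde f\circ\phi$ preserving these labels, and each cover is counted with weight $1/|\mathrm{Aut}|$. Equivalently, $H_{g;\mu}$ equals $\frac{|\mathrm{Aut}(\mu)|}{|\mu|!}$ times the number of tuples $(\tau_1,\ldots,\tau_{|\mu|+2g-2+n})$ of transpositions in $S_{|\mu|}$ generating a transitive subgroup whose product has cycle type $\mu$, where $\mathrm{Aut}(\mu)$ is the group of permutations of the entries of $\mu$ fixing it. The notation $a_g\sim b_g$ means $a_g/b_g\to 1$.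
   Formalization: The formal theorem assumes d ≥ 2: for d = 1 (and for the empty tuple) both the Hurwitz number and the right-hand side vanish for all large g, so the ratio defining ∼ is 0/0 and the claim is undefined. -}

module Defs where

open import Data.Nat using (ℕ; zero; suc; _+_; _*_; _∸_; _^_; _<_; _≤_; _<?_; _≟_; NonZero)
open import Data.Nat.Properties using (_!≢0; m*n≢0)
open import Data.Nat.Combinatorics using (_C_)
open import Data.Nat.Base using (_!)
open import Data.Bool using (Bool; true; false; _∨_; _∧_; if_then_else_)
open import Data.Fin using (Fin; toℕ)
open import Data.Fin.Properties using () renaming (_≟_ to _≟ᶠ_)
open import Data.List using (List; []; _∷_; length; filter; map; allFin; concatMap; upTo)
open import Data.Bool.ListAction using (and)
open import Data.Nat.ListAction using (sum; product)
open import Data.List.Relation.Unary.All using (All; []; _∷_)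
open import Data.Nat.Base using (>-nonZero)
open import Data.Product using (_×_; _,_; proj₁; proj₂)
open import Data.Integer using (+_)
open import Data.Rational using (ℚ; _/_)
open import Relation.Nullary using (Dec; yes; no; does)
open import Relation.Nullary.Decidable using (⌊_⌋)
open import Function using (id; _∘_)

Transposition : ℕ → Set
Transposition d = Fin d × Fin d

transpositions : (d : ℕ) → List (Transposition d)
transpositions d =
  filter (λ p → toℕ (proj₁ p) <? toℕ (proj₂ p))
         (concatMap (λ i → map (λ j → (i , j)) (allFin d)) (allFin d))

swap : ∀ {d} → Transposition d → Fin d → Fin d
swap (i , j) x with x ≟ᶠ i | x ≟ᶠ j
... | yes _ | _     = j
... | no _  | yes _ = i
... | no _  | no _  = x

tuples : ∀ {A : Set} → ℕ → List A → List (List A)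
tuples zero    xs = [] ∷ []
tuples (suc m) xs = concatMap (λ x → map (x ∷_) (tuples m xs)) xs

prodT : ∀ {d} → List (Transposition d) → Fin d → Fin d
prodT []       = id
prodT (t ∷ ts) = swap t ∘ prodT ts

-- Transitivity of the subgroup generated by a list of transpositions.
-- Subsets of Fin d are Boolean predicates.  The orbit of x under the
-- generated subgroup is the closure of {x} under the generators
-- (transpositions are involutions, so words in the generators suffice);
-- d closure steps suffice since an orbit has at most d points.

closeStep : ∀ {d} → List (Transposition d) → (Fin d → Bool) → (Fin d → Bool)
closeStep ts S y = S y ∨ anyT ts
  where
  anyT : List _ → Bool
  anyT []       = false
  anyT (t ∷ us) = S (swap t y) ∨ anyT us

iter : ∀ {A : Set} → ℕ → (A → A) → A → A
iter zero    f a = a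
iter (suc k) f a = f (iter k f a)

orbit : ∀ {d} → List (Transposition d) → Fin d → (Fin d → Bool)
orbit {d} ts x = iter d (closeStep ts) (λ y → does (y ≟ᶠ x))

isTransitive : ∀ {d} → List (Transposition d) → Bool
isTransitive {zero}  ts = true
isTransitive {suc d} ts = and (map (orbit ts Fin.zero) (allFin (suc d)))

-- Cycle type.  The orbit length of x under σ is the least k ≥ 1 with
-- σᵏ x = x.  σ has cycle type μ iff for every k the number of k-cycles
-- of σ equals the multiplicity of k in μ, i.e. the number of points
-- lying in k-cycles equals k · #{i : μᵢ = k}  (equality of multisets).

orbitLength : ∀ {d} → (Fin d → Fin d) → Fin d → ℕ
orbitLength {d} σ x = go d (σ x) 1
  where
  go : ℕ → Fin d → ℕ → ℕ
  go zero    y k = k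
  go (suc f) y k with y ≟ᶠ x
  ... | yes _ = k
  ... | no _  = go f (σ y) (suc k)

multiplicity : ℕ → List ℕ → ℕ
multiplicity k μ = length (filter (λ m → m ≟ k) μ)

pointsInCycles : ∀ {d} → (Fin d → Fin d) → ℕ → ℕ
pointsInCycles {d} σ k = length (filter (λ x → orbitLength σ x ≟ k) (allFin d))

hasCycleType : ∀ {d} → (Fin d → Fin d) → List ℕ → Bool
hasCycleType {d} σ μ =
  and (map (λ k → ⌊ pointsInCycles σ k ≟ k * multiplicity k μ ⌋) (upTo (suc d)))

numBranch : ℕ → List ℕ → ℕ
numBranch g μ = (sum μ + 2 * g + length μ) ∸ 2

hurwitzCount : ℕ → List ℕ → ℕ
hurwitzCount g μ =
  length (filter (λ ts → isTransitive ts ∧ hasCycleType (prodT ts) μ ≟b true)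
                 (tuples (numBranch g μ) (transpositions (sum μ))))
  where
  open import Data.Bool.Properties using () renaming (_≟_ to _≟b_)

autSize : List ℕ → ℕ
autSize μ = product (map (λ k → multiplicity k μ !) (upTo (suc (sum μ))))

H : ℕ → List ℕ → ℚ
H g μ = (+ (autSize μ * hurwitzCount g μ) / (sum μ !)) {{sum μ !≢0}}

prodPos : (μ : List ℕ) → All (0 <_) μ → NonZero (product μ)
prodPos []      []       = _
prodPos (m ∷ μ) (p ∷ ps) = m*n≢0 m (product μ) {{>-nonZero p}} {{prodPos μ ps}}

asymp : ℕ → (μ : List ℕ) → All (0 <_) μ → ℚ
asymp g μ pos =
  (+ (2 * (sum μ C 2) ^ numBranch g μ) / (sum μ ! * product μ))
    {{m*n≢0 (sum μ !) (product μ) {{sum μ !≢0}} {{prodPos μ pos}}}}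

{-# OPTIONS --safe #-}
module Submission where

-- Among all m-tuples of transpositions the number with product σ is governed by
-- the walk σ ↦ t ∘ σ on S_d.  After 2d steps every even permutation reaches the
-- identity with probability at least 1/N^{2d}, where N = C(d,2), so the
-- oscillation on even permutations of the number of m-step walks into a conjugacy
-- class of the right parity shrinks, relative to N^m, by the factor 1 - 1/N^{2d}
-- every 2d steps.  As the total over all d!/2 even permutations is N^m times the
-- size of the class, every such count is asymptotic to 2 N^m |class| / d!, and
-- |class| = d! / (|Aut μ| · μ₁ ⋯ μₙ).  An intransitive tuple omits some
-- transposition (0 y), so there are at most (d-1)(N-1)^m of those.

open import Defs
open import Algebra.Properties.AbelianGroup using (⁻¹-anti-homo‿-)
open import Data.Bool using (Bool; true; false; _∧_; not)
open import Data.Bool.ListAction using (and)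
open import Data.Bool.Properties using (not-involutive; ∨-zeroʳ) renaming (_≟_ to _≟ᵇ_)
open import Data.Empty using (⊥-elim)
open import Data.Fin using (Fin; zero; suc; toℕ)
open import Data.Fin.Properties using () renaming (_≟_ to _≟ᶠ_; suc-injective to sucᶠ-injective)
open import Data.Integer as ℤ using (+<+)
import Data.Integer.Properties as ℤ
import Data.Integer.Tactic.RingSolver as ℤ-Solver
open import Data.List using (List; []; _∷_; _++_; length; filter; map; foldr; allFin; concatMap; upTo; applyUpTo)
open import Data.List.Membership.Propositional using (_∈_; _∉_)
open import Data.List.Membership.Propositional.Properties using (∈-filter⁺; ∈-filter⁻; ∈-concatMap⁺; ∈-map⁺; ∈-allFin)
open import Data.List.Properties using (map-∘; map-tabulate; map-applyUpTo; map-++; map-cong; length-tabulate)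
open import Data.List.Relation.Unary.All as All using (All; []; _∷_)
open import Data.List.Relation.Unary.Any as Any using (here; there)
open import Data.Nat hiding (parity; ∣_-_∣)
open import Data.Nat.Combinatorics using (_C_; nCk+nC[k+1]≡[n+1]C[k+1]; nC1≡n)
open import Data.Nat.DivMod using (m≡m%n+[m/n]*n; m*n/n≡m; /-monoˡ-≤)
open import Data.Nat.ListAction using (sum; product)
open import Data.Nat.ListAction.Properties using (sum-++)
open import Data.Nat.Properties
open import Algebra.Properties.CommutativeSemigroup +-commutativeSemigroup using (interchange)
open import Data.Nat.Tactic.RingSolver using (solve-∀)
open import Data.Product using (_×_; _,_; proj₁; proj₂; ∃-syntax)
open import Data.Product.Properties using (≡-dec)
open import Data.Rational using (ℚ; mkℚ; 0ℚ; ∣_∣; _-_; toℚᵘ; ↧ₙ_)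
  renaming (_<_ to _<ℚ_; _*_ to _*ℚ_; _/_ to _/ℚ_; -_ to -ℚ_; *<* to *<*ℚ)
import Data.Rational.Properties as ℚ
open import Data.Rational.Unnormalised as ℚᵘ using (mkℚᵘ; *<*)
import Data.Rational.Unnormalised.Properties as ℚᵘ
open import Data.Sum using (_⊎_; inj₁; inj₂)
open import Function using (_∘_)
open import Relation.Binary.PropositionalEquality
open import Relation.Nullary using (Dec; yes; no; does; ¬_; contradiction)
open import Relation.Nullary.Decidable using (⌊_⌋; map′; _×-dec_)

-- Finite sums

-- Pointwise equal functions need not be equal as terms, so permutations cannot be enumerated and
-- compared as functions. They are replaced by codes, which factor a permutation into transpositions
-- (0 i), one per level. This single structure supplies finite sums with decidable equality, the
-- sign (the parity of the number of nonzero digits), a bound d on the distance to the identity, and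
-- a recursion for the cycle type: a new point is either fixed or inserted into an existing cycle.
-- The size of a conjugacy class follows from that recursion.
--
-- The block length 2d comes from comparing all even permutations after the same number of steps.
-- Each reaches the identity in at most d steps, in an even number of them, and repeating a
-- transposition twice pads this to exactly 2d. Only even permutations are compared because every
-- step flips the sign, so the walk never mixes the two signs at a given time.
--
-- Estimates are kept in natural numbers: a term to be subtracted on one side is added on the other,
-- and quotients are cleared until the final passage to rationals.

private variable
  A B : Set

∑ : List A → (A → ℕ) → ℕ
∑ xs f = sum (map f xs)

∑-cong : ∀ (xs : List A) {f g : A → ℕ} → (∀ x → f x ≡ g x) → ∑ xs f ≡ ∑ xs g
∑-cong xs f≗g = cong sum (map-cong f≗g xs)

∑-mono : ∀ (xs : List A) {f g : A → ℕ} → (∀ x → f x ≤ g x) → ∑ xs f ≤ ∑ xs g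
∑-mono []       f≤g = z≤n
∑-mono (x ∷ xs) f≤g = +-mono-≤ (f≤g x) (∑-mono xs f≤g)

∑-mono-∈ : ∀ (xs : List A) {f g : A → ℕ} → (∀ x → x ∈ xs → f x ≤ g x) → ∑ xs f ≤ ∑ xs g
∑-mono-∈ []       f≤g = z≤n
∑-mono-∈ (x ∷ xs) f≤g = +-mono-≤ (f≤g x (here refl)) (∑-mono-∈ xs (λ y → f≤g y ∘ there))

∑-cong-∈ : ∀ (xs : List A) {f g : A → ℕ} → (∀ x → x ∈ xs → f x ≡ g x) → ∑ xs f ≡ ∑ xs g
∑-cong-∈ []       f≗g = refl
∑-cong-∈ (x ∷ xs) f≗g = cong₂ _+_ (f≗g x (here refl)) (∑-cong-∈ xs (λ y → f≗g y ∘ there))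

∑-distrib-+ : ∀ (xs : List A) (f g : A → ℕ) → ∑ xs (λ x → f x + g x) ≡ ∑ xs f + ∑ xs g
∑-distrib-+ []       f g = refl
∑-distrib-+ (x ∷ xs) f g rewrite ∑-distrib-+ xs f g = interchange (f x) (g x) (∑ xs f) (∑ xs g)

*-distribˡ-∑ : ∀ k (xs : List A) (f : A → ℕ) → k * ∑ xs f ≡ ∑ xs (λ x → k * f x)
*-distribˡ-∑ k []       f = *-zeroʳ k
*-distribˡ-∑ k (x ∷ xs) f = trans (*-distribˡ-+ k (f x) _) (cong (k * f x +_) (*-distribˡ-∑ k xs f))

*-distribʳ-∑ : ∀ k (xs : List A) (f : A → ℕ) → ∑ xs f * k ≡ ∑ xs (λ x → f x * k)
*-distribʳ-∑ k []       f = refl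
*-distribʳ-∑ k (x ∷ xs) f = trans (*-distribʳ-+ k (f x) _) (cong (f x * k +_) (*-distribʳ-∑ k xs f))

∑-const : ∀ (xs : List A) k → ∑ xs (λ _ → k) ≡ length xs * k
∑-const []       k = refl
∑-const (x ∷ xs) k = cong (k +_) (∑-const xs k)

∑-zero : ∀ (xs : List A) {f : A → ℕ} → (∀ x → f x ≡ 0) → ∑ xs f ≡ 0
∑-zero xs f≗0 = trans (∑-cong xs f≗0) (trans (∑-const xs 0) (*-zeroʳ (length xs)))

∑-comm : ∀ (xs : List A) (ys : List B) (f : A → B → ℕ) →
         ∑ xs (λ x → ∑ ys (f x)) ≡ ∑ ys (λ y → ∑ xs (λ x → f x y))
∑-comm []       ys f = sym (∑-zero ys (λ _ → refl))
∑-comm (x ∷ xs) ys f =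
  trans (cong (∑ ys (f x) +_) (∑-comm xs ys f)) (sym (∑-distrib-+ ys (f x) _))

∑-map : ∀ (h : A → B) xs (f : B → ℕ) → ∑ (map h xs) f ≡ ∑ xs (f ∘ h)
∑-map h xs f = cong sum (sym (map-∘ xs))

∑-++ : ∀ (xs ys : List A) (f : A → ℕ) → ∑ (xs ++ ys) f ≡ ∑ xs f + ∑ ys f
∑-++ xs ys f = trans (cong sum (map-++ f xs ys)) (sum-++ (map f xs) (map f ys))

∑-concatMap : ∀ (h : A → List B) xs (f : B → ℕ) → ∑ (concatMap h xs) f ≡ ∑ xs (λ x → ∑ (h x) f)
∑-concatMap h []       f = refl
∑-concatMap h (x ∷ xs) f = trans (∑-++ (h x) (concatMap h xs) f) (cong (∑ (h x) f +_) (∑-concatMap h xs f))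

∑-allFin-suc : ∀ n (f : Fin (suc n) → ℕ) → ∑ (allFin (suc n)) f ≡ f zero + ∑ (allFin n) (f ∘ suc)
∑-allFin-suc n f =
  cong (f zero +_) (trans (cong sum (map-tabulate suc f)) (sym (cong sum (map-tabulate (λ i → i) (f ∘ suc)))))

∑-upTo-suc : ∀ n (f : ℕ → ℕ) → ∑ (upTo (suc n)) f ≡ f 0 + ∑ (upTo n) (f ∘ suc)
∑-upTo-suc n f =
  cong (f 0 +_) (trans (cong sum (map-applyUpTo suc f n)) (sym (cong sum (map-applyUpTo (λ i → i) (f ∘ suc) n))))

𝟙 : Bool → ℕ
𝟙 true  = 1
𝟙 false = 0

𝟙≤1 : ∀ b → 𝟙 b ≤ 1
𝟙≤1 true  = ≤-refl
𝟙≤1 false = z≤n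

𝟙-∧ : ∀ a b → 𝟙 (a ∧ b) ≡ 𝟙 a * 𝟙 b
𝟙-∧ true  b = sym (+-identityʳ (𝟙 b))
𝟙-∧ false b = refl

𝟙-yes : ∀ {P : Set} (P? : Dec P) → P → 𝟙 (does P?) ≡ 1
𝟙-yes (yes _) p = refl
𝟙-yes (no ¬p) p with () ← ¬p p

𝟙-no : ∀ {P : Set} (P? : Dec P) → ¬ P → 𝟙 (does P?) ≡ 0
𝟙-no (no _)  ¬p = refl
𝟙-no (yes p) ¬p with () ← ¬p p

𝟙-cong : ∀ {P Q : Set} (P? : Dec P) (Q? : Dec Q) → (P → Q) → (Q → P) → 𝟙 (does P?) ≡ 𝟙 (does Q?)
𝟙-cong P? (yes q) f g = 𝟙-yes P? (g q)
𝟙-cong P? (no ¬q) f g = 𝟙-no P? (¬q ∘ f)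

length-filter≡∑ : ∀ {P : A → Set} (P? : ∀ x → Dec (P x)) xs →
                  length (filter P? xs) ≡ ∑ xs (λ x → 𝟙 (does (P? x)))
length-filter≡∑ P? []       = refl
length-filter≡∑ P? (x ∷ xs) with does (P? x)
... | true  = cong suc (length-filter≡∑ P? xs)
... | false = length-filter≡∑ P? xs

∑-allFin-δ : ∀ {n} (j : Fin n) (f : Fin n → ℕ) → ∑ (allFin n) (λ i → 𝟙 (does (i ≟ᶠ j)) * f i) ≡ f j
∑-allFin-δ {suc n} zero f = begin
  ∑ (allFin (suc n)) g                  ≡⟨ ∑-allFin-suc n g ⟩
  1 * f zero + ∑ (allFin n) (g ∘ suc)   ≡⟨ cong₂ _+_ (*-identityˡ (f zero)) (∑-zero (allFin n) (λ _ → refl)) ⟩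
  f zero + 0                            ≡⟨ +-identityʳ _ ⟩
  f zero                                ∎
  where
  open ≡-Reasoning
  g : Fin (suc n) → ℕ
  g i = 𝟙 (does (i ≟ᶠ zero)) * f i
∑-allFin-δ {suc n} (suc j) f = trans (∑-allFin-suc n g)
  (trans (∑-cong (allFin n) (λ i → cong (_* f (suc i)) (𝟙-cong (suc i ≟ᶠ suc j) (i ≟ᶠ j) sucᶠ-injective (cong suc))))
    (∑-allFin-δ j (f ∘ suc)))
  where
  g : Fin (suc n) → ℕ
  g i = 𝟙 (does (i ≟ᶠ suc j)) * f i

-- Codes of permutations

swap-left : ∀ {d} (i j : Fin d) → swap (i , j) i ≡ j
swap-left i j with i ≟ᶠ i | i ≟ᶠ j
... | yes _ | _ = refl
... | no ¬p | _ = ⊥-elim (¬p refl)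

swap-right : ∀ {d} (i j : Fin d) → swap (i , j) j ≡ i
swap-right i j with j ≟ᶠ i | j ≟ᶠ j
... | yes p | _     = p
... | no _  | yes _ = refl
... | no _  | no ¬p = ⊥-elim (¬p refl)

swap-other : ∀ {d} (i j : Fin d) {x} → x ≢ i → x ≢ j → swap (i , j) x ≡ x
swap-other i j {x} x≢i x≢j with x ≟ᶠ i | x ≟ᶠ j
... | yes p | _     = ⊥-elim (x≢i p)
... | no _  | yes p = ⊥-elim (x≢j p)
... | no _  | no _  = refl

swap-involutive : ∀ {d} (t : Transposition d) x → swap t (swap t x) ≡ x
swap-involutive (i , j) x with x ≟ᶠ i | x ≟ᶠ j
... | yes refl | _      = swap-right x j
... | no _ | yes refl   = swap-left i x
... | no x≢i | no x≢j   = swap-other i j x≢i x≢j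

swap-injective : ∀ {d} (t : Transposition d) {x y} → swap t x ≡ swap t y → x ≡ y
swap-injective t {x} {y} eq = trans (sym (swap-involutive t x)) (trans (cong (swap t) eq) (swap-involutive t y))

swap-refl : ∀ {d} (i x : Fin d) → swap (i , i) x ≡ x
swap-refl i x with x ≟ᶠ i
... | yes x≡i = sym x≡i
... | no _    = refl

swap-comm : ∀ {d} (i j x : Fin d) → swap (i , j) x ≡ swap (j , i) x
swap-comm i j x with x ≟ᶠ i | x ≟ᶠ j
... | yes p | yes q = trans (sym q) p
... | yes _ | no _  = refl
... | no _  | yes _ = refl
... | no _  | no _  = refl

-- Conjugating (i j) by p gives (p i, p j). Only injectivity is asked, between possibly different
-- sets, so that `p` can be both `suc` and a transposition.
swap-conj : ∀ {d e} (p : Fin d → Fin e) → (∀ {x y} → p x ≡ p y → x ≡ y) →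
            ∀ i j x → swap (p i , p j) (p x) ≡ p (swap (i , j) x)
swap-conj p inj i j x with x ≟ᶠ i | x ≟ᶠ j
... | yes refl | _    = swap-left (p i) (p j)
... | no _ | yes refl = swap-right (p i) (p j)
... | no x≢i | no x≢j = swap-other (p i) (p j) (x≢i ∘ inj) (x≢j ∘ inj)

infixr 5 _∷_

-- i ∷ c encodes the permutation (0 i) ∘ c⁺, where c⁺ fixes 0 and acts as c on
-- the points suc x; every permutation of Fin d has exactly one code.
data Code : ℕ → Set where
  []  : Code 0
  _∷_ : ∀ {d} → Fin (suc d) → Code d → Code (suc d)

lift : ∀ {d} → (Fin d → Fin d) → Fin (suc d) → Fin (suc d)
lift f zero    = zero
lift f (suc x) = suc (f x)

eval : ∀ {d} → Code d → Fin d → Fin d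
eval (i ∷ c) x = swap (zero , i) (lift (eval c) x)

idCode : ∀ {d} → Code d
idCode {zero}  = []
idCode {suc d} = zero ∷ idCode

-- Each nonzero digit contributes one transposition (0 i) and a zero digit contributes the identity,
-- so this is the sign of the encoded permutation.
isOdd : ∀ {d} → Code d → Bool
isOdd []            = false
isOdd (zero  ∷ c) = isOdd c
isOdd (suc i ∷ c) = not (isOdd c)

-- Left multiplication on codes. If s fixes 0 then s (0 i) = (0 s(i)) s, which gives the last
-- clause; and (0 b)(0 i) = (0 i)(i b) for distinct nonzero i and b, which gives the last clause of
-- `act₀`.
act  : ∀ {d} → Transposition d → Code d → Code d
act₀ : ∀ {d} → Fin d → Code (suc d) → Code (suc d)

act (zero  , zero)  c       = c
act (zero  , suc b) c       = act₀ b c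
act (suc a , zero)  c       = act₀ a c
act (suc a , suc b) (i ∷ c) = swap (suc a , suc b) i ∷ act (a , b) c

act₀ b (zero  ∷ c) = suc b ∷ c
act₀ b (suc i ∷ c) with i ≟ᶠ b
... | yes _ = zero ∷ c
... | no _  = suc i ∷ act (i , b) c

lift-swap : ∀ {d} (a b : Fin d) {f g : Fin d → Fin d} → (∀ x → g x ≡ swap (a , b) (f x)) →
            ∀ x → lift g x ≡ swap (suc a , suc b) (lift f x)
lift-swap a b g≗ zero    = refl
lift-swap a b {f} g≗ (suc x) = trans (cong suc (g≗ x)) (sym (swap-conj suc sucᶠ-injective a b (f x)))

eval-act  : ∀ {d} (t : Transposition d) c x → eval (act t c) x ≡ swap t (eval c x)
eval-act₀ : ∀ {d} (b : Fin d) c x → eval (act₀ b c) x ≡ swap (zero , suc b) (eval c x)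

eval-act (zero  , zero)  c x = sym (swap-refl zero (eval c x))
eval-act (zero  , suc b) c x = eval-act₀ b c x
eval-act (suc a , zero)  c x = trans (eval-act₀ a c x) (swap-comm zero (suc a) (eval c x))
eval-act (suc a , suc b) (i ∷ c) x = begin
  swap (zero , swap s i) (lift (eval (act (a , b) c)) x)
    ≡⟨ cong (swap (zero , swap s i)) (lift-swap a b (eval-act (a , b) c) x) ⟩
  swap (swap s zero , swap s i) (swap s y)
    ≡⟨ swap-conj (swap s) (swap-injective s) zero i y ⟩
  swap s (swap (zero , i) y) ∎
  where
  open ≡-Reasoning
  s = (suc a , suc b)
  y = lift (eval c) x

eval-act₀ b (zero  ∷ c) x = cong (swap (zero , suc b)) (sym (swap-refl zero (lift (eval c) x)))
eval-act₀ b (suc i ∷ c) x with i ≟ᶠ b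
... | yes refl = trans (swap-refl zero (lift (eval c) x)) (sym (swap-involutive (zero , suc i) (lift (eval c) x)))
... | no i≢b   = begin
  swap s (lift (eval (act (i , b) c)) x)   ≡⟨ cong (swap s) (lift-swap i b (eval-act (i , b) c) x) ⟩
  swap s (swap (suc i , suc b) y)          ≡⟨ swap-conj (swap s) (swap-injective s) (suc i) (suc b) y ⟨
  swap (swap s (suc i) , swap s (suc b)) (swap s y)
    ≡⟨ cong₂ (λ u v → swap (u , v) (swap s y)) (swap-right zero (suc i))
         (swap-other zero (suc i) (λ ()) (λ p → i≢b (sym (sucᶠ-injective p)))) ⟩
  swap (zero , suc b) (swap s y)           ∎
  where
  open ≡-Reasoning
  s = (zero , suc i)
  y = lift (eval c) x

isOdd-act  : ∀ {d} (t : Transposition d) c → proj₁ t ≢ proj₂ t → isOdd (act t c) ≡ not (isOdd c)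
isOdd-act₀ : ∀ {d} (b : Fin d) c → isOdd (act₀ b c) ≡ not (isOdd c)

isOdd-act (zero  , zero)  c       a≢b = ⊥-elim (a≢b refl)
isOdd-act (zero  , suc b) c       a≢b = isOdd-act₀ b c
isOdd-act (suc a , zero)  c       a≢b = isOdd-act₀ a c
isOdd-act (suc a , suc b) (zero ∷ c) a≢b =
  isOdd-act (a , b) c (a≢b ∘ cong suc)
isOdd-act (suc a , suc b) (suc i ∷ c) a≢b rewrite swap-conj suc sucᶠ-injective a b i =
  cong not (isOdd-act (a , b) c (a≢b ∘ cong suc))

isOdd-act₀ b (zero ∷ c) = refl
isOdd-act₀ b (suc i ∷ c) with i ≟ᶠ b
... | yes _  = sym (not-involutive (isOdd c))
... | no i≢b = cong not (isOdd-act (i , b) c i≢b)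

-- The leading digit is the image of 0, and cancelling (0 i) leaves the shorter code. This takes the
-- place of extensionality: equations between codes are verified pointwise through `eval`.
eval-injective : ∀ {d} (c c′ : Code d) → (∀ x → eval c x ≡ eval c′ x) → c ≡ c′
eval-injective []      []        eq = refl
eval-injective (i ∷ c) (i′ ∷ c′) eq
  with refl ← trans (sym (swap-left zero i)) (trans (eq zero) (swap-left zero i′)) =
  cong (i ∷_) (eval-injective c c′ (λ x → sucᶠ-injective (swap-injective (zero , i) (eq (suc x)))))

act-involutive : ∀ {d} (t : Transposition d) c → act t (act t c) ≡ c
act-involutive t c = eval-injective _ c λ x →
  trans (eval-act t (act t c) x) (trans (cong (swap t) (eval-act t c x)) (swap-involutive t (eval c x)))

eval-idCode : ∀ {d} (x : Fin d) → eval idCode x ≡ x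
eval-idCode zero    = refl
eval-idCode (suc x) = trans (swap-refl zero (suc (eval idCode x))) (cong suc (eval-idCode x))

codeOf : ∀ {d} → List (Transposition d) → Code d
codeOf = foldr act idCode

eval-codeOf : ∀ {d} (ts : List (Transposition d)) x → eval (codeOf ts) x ≡ prodT ts x
eval-codeOf []       x = eval-idCode x
eval-codeOf (t ∷ ts) x = trans (eval-act t (codeOf ts) x) (cong (swap t) (eval-codeOf ts x))

∷-injective : ∀ {d} {i j : Fin (suc d)} {c c′ : Code d} → i ∷ c ≡ j ∷ c′ → i ≡ j × c ≡ c′
∷-injective refl = refl , refl

_≟ᶜ_ : ∀ {d} (c c′ : Code d) → Dec (c ≡ c′)
[]      ≟ᶜ []        = yes refl
(i ∷ c) ≟ᶜ (j ∷ c′) = map′ (λ { (refl , refl) → refl }) ∷-injective ((i ≟ᶠ j) ×-dec (c ≟ᶜ c′))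

codes : ∀ d → List (Code d)
codes zero    = [] ∷ []
codes (suc d) = concatMap (λ i → map (i ∷_) (codes d)) (allFin (suc d))

∑-codes-suc : ∀ d (f : Code (suc d) → ℕ) →
              ∑ (codes (suc d)) f ≡ ∑ (allFin (suc d)) (λ i → ∑ (codes d) (λ c → f (i ∷ c)))
∑-codes-suc d f = trans (∑-concatMap (λ i → map (i ∷_) (codes d)) (allFin (suc d)) f)
  (∑-cong (allFin (suc d)) (λ i → ∑-map (i ∷_) (codes d) f))

∑-codes-1 : ∀ d → ∑ (codes d) (λ _ → 1) ≡ d !
∑-codes-1 zero    = refl
∑-codes-1 (suc d) = begin
  ∑ (codes (suc d)) (λ _ → 1)                              ≡⟨ ∑-codes-suc d (λ _ → 1) ⟩
  ∑ (allFin (suc d)) (λ i → ∑ (codes d) (λ c → 1))         ≡⟨ ∑-cong (allFin (suc d)) (λ _ → ∑-codes-1 d) ⟩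
  ∑ (allFin (suc d)) (λ i → d !)                           ≡⟨ ∑-const (allFin (suc d)) (d !) ⟩
  length (allFin (suc d)) * d !                            ≡⟨ cong (_* d !) (length-tabulate {n = suc d} (λ i → i)) ⟩
  suc d * d !                                              ∎
  where
  open ≡-Reasoning

∑-codes-δ : ∀ {d} (x : Code d) (f : Code d → ℕ) → ∑ (codes d) (λ c → 𝟙 (does (c ≟ᶜ x)) * f c) ≡ f x
∑-codes-δ []      f = trans (+-identityʳ _) (*-identityˡ (f []))
∑-codes-δ {suc d} (j ∷ x) f = begin
  ∑ (codes (suc d)) (λ c → 𝟙 (does (c ≟ᶜ (j ∷ x))) * f c)
    ≡⟨ ∑-codes-suc d _ ⟩
  ∑ (allFin (suc d)) (λ i → ∑ (codes d) (λ c → 𝟙 (does (i ≟ᶠ j) ∧ does (c ≟ᶜ x)) * f (i ∷ c)))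
    ≡⟨ ∑-cong (allFin (suc d)) (λ i → trans (∑-cong (codes d) (λ c →
         trans (cong (_* f (i ∷ c)) (𝟙-∧ (does (i ≟ᶠ j)) (does (c ≟ᶜ x)))) (*-assoc (𝟙 (does (i ≟ᶠ j))) _ _)))
         (sym (*-distribˡ-∑ (𝟙 (does (i ≟ᶠ j))) (codes d) _))) ⟩
  ∑ (allFin (suc d)) (λ i → 𝟙 (does (i ≟ᶠ j)) * ∑ (codes d) (λ c → 𝟙 (does (c ≟ᶜ x)) * f (i ∷ c)))
    ≡⟨ ∑-allFin-δ j _ ⟩
  ∑ (codes d) (λ c → 𝟙 (does (c ≟ᶜ x)) * f (j ∷ c))
    ≡⟨ ∑-codes-δ x (λ c → f (j ∷ c)) ⟩
  f (j ∷ x) ∎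
  where open ≡-Reasoning

-- Reindexing by summing over the graph of `p`: since `p` is an involution, b = p c holds exactly
-- when c = p b, and the order of summation can be exchanged.
∑-codes-involution : ∀ {d} (p : Code d → Code d) → (∀ c → p (p c) ≡ c) → (f : Code d → ℕ) →
                     ∑ (codes d) (f ∘ p) ≡ ∑ (codes d) f
∑-codes-involution {d} p p² f = begin
  ∑ (codes d) (λ c → f (p c))
    ≡⟨ ∑-cong (codes d) (λ c → sym (∑-codes-δ (p c) f)) ⟩
  ∑ (codes d) (λ c → ∑ (codes d) (λ b → 𝟙 (does (b ≟ᶜ p c)) * f b))
    ≡⟨ ∑-comm (codes d) (codes d) _ ⟩
  ∑ (codes d) (λ b → ∑ (codes d) (λ c → 𝟙 (does (b ≟ᶜ p c)) * f b))
    ≡⟨ ∑-cong (codes d) (λ b → ∑-cong (codes d) (λ c → cong (_* f b)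
         (𝟙-cong (b ≟ᶜ p c) (c ≟ᶜ p b) (λ e → trans (sym (p² c)) (cong p (sym e)))
           (λ e → trans (sym (p² b)) (cong p (sym e)))))) ⟩
  ∑ (codes d) (λ b → ∑ (codes d) (λ c → 𝟙 (does (c ≟ᶜ p b)) * f b))
    ≡⟨ ∑-cong (codes d) (λ b → ∑-codes-δ (p b) (λ _ → f b)) ⟩
  ∑ (codes d) f ∎
  where open ≡-Reasoning

-- The transposition walk

∈-transpositions : ∀ {d} (i j : Fin d) → toℕ i < toℕ j → (i , j) ∈ transpositions d
∈-transpositions {d} i j i<j =
  ∈-filter⁺ (λ p → toℕ (proj₁ p) <? toℕ (proj₂ p))
    (∈-concatMap⁺ (λ i → map (i ,_) (allFin d)) {xs = allFin d}
      (Any.map (λ { refl → ∈-map⁺ (i ,_) (∈-allFin j) }) (∈-allFin i)))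
    i<j

transposition-< : ∀ {d} {t : Transposition d} → t ∈ transpositions d → toℕ (proj₁ t) < toℕ (proj₂ t)
transposition-< {d} t∈ =
  proj₂ (∈-filter⁻ (λ p → toℕ (proj₁ p) <? toℕ (proj₂ p))
    {xs = concatMap (λ i → map (i ,_) (allFin d)) (allFin d)} t∈)

isOdd-step : ∀ {d} {t : Transposition d} → t ∈ transpositions d → ∀ c → isOdd (act t c) ≡ not (isOdd c)
isOdd-step {t = t} t∈ c = isOdd-act t c (λ eq → <⇒≢ (transposition-< t∈) (cong toℕ eq))

-- The unnormalised transition operator: with N transpositions, `P^ m φ c` is the total of `φ` over
-- the endpoints of the N^m walks of m steps from `c`.
P : ∀ {d} → (Code d → ℕ) → Code d → ℕ
P {d} φ c = ∑ (transpositions d) (λ t → φ (act t c))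

P^ : ∀ {d} → ℕ → (Code d → ℕ) → Code d → ℕ
P^ zero    φ = φ
P^ (suc m) φ = P^ m (P φ)

P^-suc : ∀ {d} m (φ : Code d → ℕ) c → P^ (suc m) φ c ≡ P (P^ m φ) c
P^-suc zero    φ c = refl
P^-suc (suc m) φ c = P^-suc m (P φ) c

P^-+ : ∀ {d} m n (φ : Code d → ℕ) → P^ (m + n) φ ≡ P^ n (P^ m φ)
P^-+ zero    n φ = refl
P^-+ (suc m) n φ = P^-+ m n (P φ)

-- The head of a tuple acts last on the product, so summing over the head first replaces `φ` by
-- `P φ` evaluated on the tail.
∑-tuples : ∀ {d} m (φ : Code d → ℕ) → ∑ (tuples m (transpositions d)) (φ ∘ codeOf) ≡ P^ m φ idCode
∑-tuples zero φ = +-identityʳ (φ idCode)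
∑-tuples {d} (suc m) φ = begin
  ∑ (tuples (suc m) T) (φ ∘ codeOf)
    ≡⟨ ∑-concatMap (λ t → map (t ∷_) (tuples m T)) T (φ ∘ codeOf) ⟩
  ∑ T (λ t → ∑ (map (t ∷_) (tuples m T)) (φ ∘ codeOf))
    ≡⟨ ∑-cong T (λ t → ∑-map (t ∷_) (tuples m T) (φ ∘ codeOf)) ⟩
  ∑ T (λ t → ∑ (tuples m T) (λ ts → φ (act t (codeOf ts))))
    ≡⟨ ∑-comm T (tuples m T) _ ⟩
  ∑ (tuples m T) (P φ ∘ codeOf)
    ≡⟨ ∑-tuples m (P φ) ⟩
  P^ m (P φ) idCode ∎
  where
  open ≡-Reasoning
  T = transpositions d

∑-P : ∀ {d} (φ : Code d → ℕ) → ∑ (codes d) (P φ) ≡ length (transpositions d) * ∑ (codes d) φ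
∑-P {d} φ = begin
  ∑ (codes d) (P φ)                                      ≡⟨ ∑-comm (codes d) T _ ⟩
  ∑ T (λ t → ∑ (codes d) (φ ∘ act t))                    ≡⟨ ∑-cong T (λ t → ∑-codes-involution (act t) (act-involutive t) φ) ⟩
  ∑ T (λ _ → ∑ (codes d) φ)                              ≡⟨ ∑-const T _ ⟩
  length T * ∑ (codes d) φ                               ∎
  where
  open ≡-Reasoning
  T = transpositions d

∑-P^ : ∀ {d} m (φ : Code d → ℕ) → ∑ (codes d) (P^ m φ) ≡ length (transpositions d) ^ m * ∑ (codes d) φ
∑-P^ zero    φ = sym (+-identityʳ _)
∑-P^ {d} (suc m) φ = begin
  ∑ (codes d) (P^ m (P φ))           ≡⟨ ∑-P^ m (P φ) ⟩
  N ^ m * ∑ (codes d) (P φ)          ≡⟨ cong (N ^ m *_) (∑-P φ) ⟩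
  N ^ m * (N * ∑ (codes d) φ)        ≡⟨ rearrange (N ^ m) N _ ⟩
  N * N ^ m * ∑ (codes d) φ          ∎
  where
  open ≡-Reasoning
  N = length (transpositions d)
  rearrange : ∀ a b s → a * (b * s) ≡ b * a * s
  rearrange = solve-∀

-- Adds the parity of m to b; the recursion runs on the argument so as to unfold in step with `P^`.
not^ : ℕ → Bool → Bool
not^ zero    b = b
not^ (suc m) b = not^ m (not b)

VanishesOff : ∀ {d} → Bool → (Code d → ℕ) → Set
VanishesOff b φ = ∀ c → isOdd c ≢ b → φ c ≡ 0

P-vanishesOff : ∀ {d} b {φ : Code d → ℕ} → VanishesOff b φ → VanishesOff (not b) (P φ)
P-vanishesOff {d} b {φ} v c odd≢ =
  trans (∑-cong-∈ (transpositions d) {g = λ _ → 0} (λ t t∈ → v (act t c)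
    (λ eq → odd≢ (trans (sym (not-involutive _)) (cong not (trans (sym (isOdd-step t∈ c)) eq))))))
  (∑-zero (transpositions d) (λ _ → refl))

P^-vanishesOff : ∀ {d} m b {φ : Code d → ℕ} → VanishesOff b φ → VanishesOff (not^ m b) (P^ m φ)
P^-vanishesOff zero    b v = v
P^-vanishesOff (suc m) b v = P^-vanishesOff m (not b) (P-vanishesOff b v)

-- The gaps f - g are nonnegative along the list, so their total is at least the single gap at `x`;
-- both differences are written as sums.
∑-exchange : ∀ {A : Set} {xs : List A} {x} → x ∈ xs → (f g : A → ℕ) → (∀ y → y ∈ xs → g y ≤ f y) →
             f x + ∑ xs g ≤ ∑ xs f + g x
∑-exchange {xs = y ∷ xs} (here refl) f g g≤f = begin
  f y + (g y + ∑ xs g)   ≡⟨ rearrange (f y) (g y) (∑ xs g) ⟩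
  f y + ∑ xs g + g y     ≤⟨ +-monoˡ-≤ (g y) (+-monoʳ-≤ (f y) (∑-mono-∈ xs (λ z → g≤f z ∘ there))) ⟩
  f y + ∑ xs f + g y     ∎
  where
  open ≤-Reasoning
  rearrange : ∀ a b c → a + (b + c) ≡ a + c + b
  rearrange = solve-∀
∑-exchange {xs = y ∷ xs} {x} (there x∈) f g g≤f = begin
  f x + (g y + ∑ xs g)   ≡⟨ rearrange (f x) (g y) (∑ xs g) ⟩
  g y + (f x + ∑ xs g)   ≤⟨ +-mono-≤ (g≤f y (here refl)) (∑-exchange x∈ f g (λ z → g≤f z ∘ there)) ⟩
  f y + (∑ xs f + g x)   ≡⟨ +-assoc (f y) _ _ ⟨
  f y + ∑ xs f + g x     ∎
  where
  open ≤-Reasoning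
  rearrange : ∀ a b c → a + (b + c) ≡ b + (a + c)
  rearrange = solve-∀

-- Paths of prescribed length and contraction of the oscillation on even permutations.

data Path {d} : ℕ → Code d → Code d → Set where
  done : ∀ {c} → Path 0 c c
  step : ∀ {n c x} t → t ∈ transpositions d → Path n (act t c) x → Path (suc n) c x

module _ {d : ℕ} where
  private N = length (transpositions d)

  -- All walks of n steps from `c` end at codes of one parity, so a bound on that half is enough.
  -- This is what later lets bounds on even codes alone propagate.
  P^-≤ : ∀ n {ψ : Code d → ℕ} {U} c → (∀ z → isOdd z ≡ not^ n (isOdd c) → ψ z ≤ U) → P^ n ψ c ≤ N ^ n * U
  P^-≤ zero    {U = U} c ψ≤U = ≤-trans (ψ≤U c refl) (≤-reflexive (sym (+-identityʳ U)))
  P^-≤ (suc n) {ψ} {U} c ψ≤U = begin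
    P^ (suc n) ψ c                              ≡⟨ P^-suc n ψ c ⟩
    ∑ (transpositions d) (λ t → P^ n ψ (act t c)) ≤⟨ ∑-mono-∈ (transpositions d) (λ t t∈ → P^-≤ n (act t c)
                                                  (λ z eq → ψ≤U z (trans eq (cong (not^ n) (isOdd-step t∈ c))))) ⟩
    ∑ (transpositions d) (λ _ → N ^ n * U)      ≡⟨ ∑-const (transpositions d) _ ⟩
    N * (N ^ n * U)                             ≡⟨ *-assoc N (N ^ n) U ⟨
    N ^ suc n * U                               ∎
    where open ≤-Reasoning

  P^-≥ : ∀ n {ψ : Code d → ℕ} {L} c → (∀ z → isOdd z ≡ not^ n (isOdd c) → L ≤ ψ z) → N ^ n * L ≤ P^ n ψ c
  P^-≥ zero    {L = L} c L≤ψ = ≤-trans (≤-reflexive (+-identityʳ L)) (L≤ψ c refl)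
  P^-≥ (suc n) {ψ} {L} c L≤ψ = begin
    N ^ suc n * L                               ≡⟨ *-assoc N (N ^ n) L ⟩
    N * (N ^ n * L)                             ≡⟨ ∑-const (transpositions d) _ ⟨
    ∑ (transpositions d) (λ _ → N ^ n * L)      ≤⟨ ∑-mono-∈ (transpositions d) (λ t t∈ → P^-≥ n (act t c)
                                                  (λ z eq → L≤ψ z (trans eq (cong (not^ n) (isOdd-step t∈ c))))) ⟩
    ∑ (transpositions d) (λ t → P^ n ψ (act t c)) ≡⟨ P^-suc n ψ c ⟨
    P^ (suc n) ψ c                              ∎
    where open ≤-Reasoning

  -- Of the N^n walks from `c`, one follows the given path and contributes `ψ x`; the other N^n - 1
  -- contribute at most `U` each. The missing `U` is added on the left.
  path-≤ : ∀ {n c x} → Path n c x → ∀ {ψ : Code d → ℕ} {U} → (∀ z → isOdd z ≡ not^ n (isOdd c) → ψ z ≤ U) →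
           P^ n ψ c + U ≤ ψ x + N ^ n * U
  path-≤ {x = x} done {ψ} {U} ψ≤U = +-monoʳ-≤ (ψ x) (≤-reflexive (sym (+-identityʳ U)))
  -- After adding `f t + W` to both sides, the claim is the sum of the exchange inequality over the
  -- first step and the induction hypothesis for the rest of the path.
  path-≤ {suc n} {c} {x} (step t t∈ p) {ψ} {U} ψ≤U = +-cancelˡ-≤ (f t + W) _ _ (begin
    f t + W + (P^ (suc n) ψ c + U)            ≡⟨ cong (λ s → f t + W + (s + U)) (P^-suc n ψ c) ⟩
    f t + W + (∑ (transpositions d) f + U)    ≡⟨ rearrange₁ (f t) W (∑ (transpositions d) f) U ⟩
    (W + ∑ (transpositions d) f) + (f t + U)  ≤⟨ +-mono-≤ (∑-exchange t∈ (λ _ → W) f bound)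
                                                   (path-≤ p (λ z eq → ψ≤U z (trans eq (cong (not^ n) (isOdd-step t∈ c))))) ⟩
    (∑ (transpositions d) (λ _ → W) + f t) + (ψ x + W)  ≡⟨ cong (λ s → (s + f t) + (ψ x + W)) (∑-const (transpositions d) W) ⟩
    (N * W + f t) + (ψ x + W)                 ≡⟨ rearrange₂ N (N ^ n) U (f t) (ψ x) ⟩
    f t + W + (ψ x + N ^ suc n * U)           ∎)
    where
    open ≤-Reasoning
    W = N ^ n * U
    f : Transposition d → ℕ
    f s = P^ n ψ (act s c)
    bound : ∀ s → s ∈ transpositions d → f s ≤ W
    bound s s∈ = P^-≤ n (act s c) (λ z eq → ψ≤U z (trans eq (cong (not^ n) (isOdd-step s∈ c))))
    rearrange₁ : ∀ a w s u → a + w + (s + u) ≡ (w + s) + (a + u)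
    rearrange₁ = solve-∀
    rearrange₂ : ∀ n m u a x → (n * (m * u) + a) + (x + m * u) ≡ a + m * u + (x + (n * m) * u)
    rearrange₂ = solve-∀

  -- The mirror image: the N^n - 1 walks off the path contribute at least `L` each.
  path-≥ : ∀ {n c x} → Path n c x → ∀ {ψ : Code d → ℕ} {L} → (∀ z → isOdd z ≡ not^ n (isOdd c) → L ≤ ψ z) →
           ψ x + N ^ n * L ≤ P^ n ψ c + L
  path-≥ {x = x} done {ψ} {L} L≤ψ = +-monoʳ-≤ (ψ x) (≤-reflexive (+-identityʳ L))
  path-≥ {suc n} {c} {x} (step t t∈ p) {ψ} {L} L≤ψ = +-cancelˡ-≤ (f t + W) _ _ (begin
    f t + W + (ψ x + N ^ suc n * L)           ≡⟨ rearrange₂ N (N ^ n) L (f t) (ψ x) ⟨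
    (f t + N * W) + (ψ x + W)                 ≡⟨ cong (λ s → (f t + s) + (ψ x + W)) (∑-const (transpositions d) W) ⟨
    (f t + ∑ (transpositions d) (λ _ → W)) + (ψ x + W)
                                              ≤⟨ +-mono-≤ (∑-exchange t∈ f (λ _ → W) bound)
                                                   (path-≥ p (λ z eq → L≤ψ z (trans eq (cong (not^ n) (isOdd-step t∈ c))))) ⟩
    (∑ (transpositions d) f + W) + (f t + L)  ≡⟨ rearrange₁ (f t) W (∑ (transpositions d) f) L ⟨
    f t + W + (∑ (transpositions d) f + L)    ≡⟨ cong (λ s → f t + W + (s + L)) (P^-suc n ψ c) ⟨
    f t + W + (P^ (suc n) ψ c + L)            ∎)
    where
    open ≤-Reasoning
    W = N ^ n * L
    f : Transposition d → ℕ
    f s = P^ n ψ (act s c)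
    bound : ∀ s → s ∈ transpositions d → W ≤ f s
    bound s s∈ = P^-≥ n (act s c) (λ z eq → L≤ψ z (trans eq (cong (not^ n) (isOdd-step s∈ c))))
    rearrange₁ : ∀ a w s u → a + w + (s + u) ≡ (s + w) + (a + u)
    rearrange₁ = solve-∀
    rearrange₂ : ∀ n m u a x → (a + n * (m * u)) + (x + m * u) ≡ a + m * u + (x + (n * m) * u)
    rearrange₂ = solve-∀

path-lift : ∀ {d n} {c x : Code d} → Path n c x → Path n (zero ∷ c) (zero ∷ x)
path-lift done = done
path-lift (step (a , b) t∈ p) =
  step (suc a , suc b) (∈-transpositions (suc a) (suc b) (s≤s (transposition-< t∈))) (path-lift p)

act₀-cancel : ∀ {d} (i : Fin d) c → act₀ i (suc i ∷ c) ≡ zero ∷ c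
act₀-cancel i c with i ≟ᶠ i
... | yes _  = refl
... | no i≢i = ⊥-elim (i≢i refl)

-- Every nonzero digit i is removed by one multiplication with (0 i). The length is the number of
-- nonzero digits, hence at most d and of the parity of the code.
path-to-id : ∀ {d} (c : Code d) → ∃[ n ] (n ≤ d × not^ n (isOdd c) ≡ false × Path n c idCode)
path-to-id []          = 0 , z≤n , refl , done
path-to-id (zero ∷ c) with n , n≤d , even , p ← path-to-id c = n , m≤n⇒m≤1+n n≤d , even , path-lift p
path-to-id {suc d} (suc i ∷ c) with n , n≤d , even , p ← path-to-id c =
  suc n , s≤s n≤d , trans (cong (not^ n) (not-involutive (isOdd c))) even ,
  step (zero , suc i) (∈-transpositions zero (suc i) (s≤s z≤n))
    (subst (λ b → Path n b (zero ∷ idCode)) (sym (act₀-cancel i c)) (path-lift p))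

not^-even : ∀ n → not^ n false ≡ false → ∃[ k ] n ≡ k * 2
not^-even zero          _  = 0 , refl
not^-even (suc (suc n)) eq with k , refl ← not^-even n eq = suc k , refl

not^-*2 : ∀ k b → not^ (k * 2) b ≡ b
not^-*2 zero    b = refl
not^-*2 (suc k) b = trans (cong (not^ (k * 2)) (not-involutive b)) (not^-*2 k b)

module _ {d : ℕ} {t₀ : Transposition d} (t₀∈ : t₀ ∈ transpositions d) where
  private N = length (transpositions d)

  -- Applying `t₀` twice changes nothing, so a path may be lengthened by any even number of steps.
  path-pad : ∀ h {n} {c x : Code d} → Path n c x → Path (h * 2 + n) c x
  path-pad zero    p = p
  path-pad (suc h) {n} {c} {x} p =
    step t₀ t₀∈ (step t₀ t₀∈ (subst (λ b → Path (h * 2 + n) b x) (sym (act-involutive t₀ c)) (path-pad h p)))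

  path-even : ∀ (c : Code d) → isOdd c ≡ false → Path (d * 2) c idCode
  path-even c even with n , n≤d , eq , p ← path-to-id c
    with k , refl ← not^-even n (subst (λ b → not^ n b ≡ false) even eq) =
    subst (λ m → Path m c idCode) length-eq (path-pad (d ∸ k) p)
    where
    length-eq : (d ∸ k) * 2 + k * 2 ≡ d * 2
    -- Since k ≤ 2k ≤ d, the truncated subtraction is exact.
    length-eq = trans (sym (*-distribʳ-+ 2 (d ∸ k) k)) (cong (_* 2) (m∸n+n≡m (≤-trans (m≤m*n k 2) n≤d)))

  Band : (Code d → ℕ) → ℕ → ℕ → Set
  Band ψ L δ = ∀ c → isOdd c ≡ false → L ≤ ψ c × ψ c ≤ L + δ

  -- From every even code at least one of the N^(2d) = a + 1 walks ends at the identity, so all even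
  -- codes share the term `ψ idCode`. Only the other a endpoints can vary, each within a width `δ`:
  -- the width grows by the factor a while the number of walks grows by a + 1.
  band-step : ∀ {a} → N ^ (d * 2) ≡ suc a → ∀ {ψ L δ} → Band ψ L δ → Band (P^ (d * 2) ψ) (ψ idCode + a * L) (a * δ)
  band-step {a} N≡ {ψ} {L} {δ} band c even = lower , upper
    where
    open ≤-Reasoning
    parity : ∀ z → isOdd z ≡ not^ (d * 2) (isOdd c) → isOdd z ≡ false
    parity z eq = trans eq (trans (not^-*2 d (isOdd c)) even)
    rearrange : ∀ x u a → x + (u + a * u) ≡ x + a * u + u
    rearrange = solve-∀
    lower : ψ idCode + a * L ≤ P^ (d * 2) ψ c
    lower = +-cancelʳ-≤ L _ _ (begin
      ψ idCode + a * L + L               ≡⟨ rearrange (ψ idCode) L a ⟨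
      ψ idCode + suc a * L               ≡⟨ cong (λ m → ψ idCode + m * L) N≡ ⟨
      ψ idCode + N ^ (d * 2) * L         ≤⟨ path-≥ (path-even c even) (λ z eq → proj₁ (band z (parity z eq))) ⟩
      P^ (d * 2) ψ c + L                 ∎)
    upper : P^ (d * 2) ψ c ≤ ψ idCode + a * L + a * δ
    upper = +-cancelʳ-≤ (L + δ) _ _ (begin
      P^ (d * 2) ψ c + (L + δ)           ≤⟨ path-≤ (path-even c even) (λ z eq → proj₂ (band z (parity z eq))) ⟩
      ψ idCode + N ^ (d * 2) * (L + δ)   ≡⟨ cong (λ m → ψ idCode + m * (L + δ)) N≡ ⟩
      ψ idCode + suc a * (L + δ)         ≡⟨ rearrange (ψ idCode) (L + δ) a ⟩
      ψ idCode + a * (L + δ) + (L + δ)   ≡⟨ cong (λ s → ψ idCode + s + (L + δ)) (*-distribˡ-+ a L δ) ⟩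
      ψ idCode + (a * L + a * δ) + (L + δ) ≡⟨ cong (_+ (L + δ)) (+-assoc (ψ idCode) _ _) ⟨
      ψ idCode + a * L + a * δ + (L + δ) ∎)

  band-steps : ∀ {a} → N ^ (d * 2) ≡ suc a → ∀ q {ψ L δ} → Band ψ L δ →
               ∃[ L′ ] Band (P^ (q * (d * 2)) ψ) L′ (a ^ q * δ)
  band-steps N≡ zero {ψ} {L} {δ} band = L , subst (Band ψ L) (sym (+-identityʳ δ)) band
  band-steps {a} N≡ (suc q) {ψ} {L} {δ} band with L′ , band′ ← band-steps N≡ q (band-step N≡ band) =
    L′ , subst₂ (λ χ ε → Band χ L′ ε) (sym (P^-+ (d * 2) (q * (d * 2)) ψ)) (rearrange (a ^ q) a δ) band′
    where
    rearrange : ∀ x a δ → x * (a * δ) ≡ a * x * δ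
    rearrange = solve-∀

  evenCodes : ℕ
  evenCodes = ∑ (codes d) (λ c → 𝟙 (not (isOdd c)))

  -- Multiplication by `t₀` matches even codes with odd ones, so of `c` and `act t₀ c` exactly one
  -- is even.
  evenCodes+evenCodes≡d! : evenCodes + evenCodes ≡ d !
  evenCodes+evenCodes≡d! = begin
    evenCodes + evenCodes
      ≡⟨ cong (evenCodes +_) (sym (∑-codes-involution (act t₀) (act-involutive t₀) (λ c → 𝟙 (not (isOdd c))))) ⟩
    evenCodes + ∑ (codes d) (λ c → 𝟙 (not (isOdd (act t₀ c))))
      ≡⟨ ∑-distrib-+ (codes d) _ _ ⟨
    ∑ (codes d) (λ c → 𝟙 (not (isOdd c)) + 𝟙 (not (isOdd (act t₀ c))))
      ≡⟨ ∑-cong (codes d) (λ c → trans (cong (λ b → 𝟙 (not (isOdd c)) + 𝟙 (not b)) (isOdd-step t₀∈ c)) (pair (isOdd c))) ⟩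
    ∑ (codes d) (λ _ → 1)
      ≡⟨ ∑-codes-1 d ⟩
    d ! ∎
    where
    open ≡-Reasoning
    pair : ∀ b → 𝟙 (not b) + 𝟙 (not (not b)) ≡ 1
    pair true  = refl
    pair false = refl

  -- The r leftover steps come first and give values in [0, N^r]; each of the q blocks then
  -- multiplies the width by a. The value at the identity and the mean over even codes lie in the
  -- same band, hence differ by at most `δ`. Multiplying by d!, which is twice the number of even
  -- codes, clears the denominator of the mean.
  equidistribution :
    ∀ {a} → N ^ (d * 2) ≡ suc a → ∀ {φ b} → (∀ c → φ c ≤ 1) → VanishesOff b φ →
    ∀ r q → not^ (r + q * (d * 2)) b ≡ false →
    let m = r + q * (d * 2); M = 2 * (N ^ m * ∑ (codes d) φ); δ = a ^ q * N ^ r in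
    d ! * P^ m φ idCode ≤ M + d ! * δ × M ≤ d ! * P^ m φ idCode + d ! * δ
  equidistribution {a} N≡ {φ} {b} φ≤1 vanish r q m-even = upper , lower
    where
    open ≤-Reasoning
    m = r + q * (d * 2)
    δ = a ^ q * N ^ r
    ψ = P^ m φ
    E = evenCodes
    Σψ = N ^ m * ∑ (codes d) φ
    band₀ : Band (P^ r φ) 0 (N ^ r)
    band₀ c _ = z≤n , ≤-trans (P^-≤ r c (λ z _ → φ≤1 z)) (≤-reflexive (*-identityʳ (N ^ r)))
    bandψ : ∃[ L ] Band ψ L δ
    bandψ with L , band ← band-steps N≡ q band₀ = L , subst (λ χ → Band χ L δ) (sym (P^-+ r (q * (d * 2)) φ)) band
    L = proj₁ bandψ
    band = proj₂ bandψ
    id-even : ∀ {e} → isOdd (idCode {e}) ≡ false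
    id-even {zero}  = refl
    id-even {suc e} = id-even {e}
    -- m steps carry the parity b to even, so `ψ` has no mass on odd codes and its total over all
    -- codes is the total over even ones.
    ψ-odd : ∀ c → isOdd c ≡ true → ψ c ≡ 0
    ψ-odd c odd = P^-vanishesOff m b vanish c (λ eq → contradiction (trans (sym odd) (trans eq m-even)) λ ())
    ψ-lower : ∀ c → 𝟙 (not (isOdd c)) * L ≤ ψ c
    ψ-lower c with isOdd c in eq
    ... | true  = z≤n
    ... | false = ≤-trans (≤-reflexive (+-identityʳ L)) (proj₁ (band c eq))
    ψ-upper : ∀ c → ψ c ≤ 𝟙 (not (isOdd c)) * (L + δ)
    ψ-upper c with isOdd c in eq
    ... | true  = ≤-reflexive (ψ-odd c eq)
    ... | false = ≤-trans (proj₂ (band c eq)) (≤-reflexive (sym (+-identityʳ _)))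
    sum-lower : E * L ≤ Σψ
    sum-lower = begin
      E * L                                          ≡⟨ *-distribʳ-∑ L (codes d) _ ⟩
      ∑ (codes d) (λ c → 𝟙 (not (isOdd c)) * L)      ≤⟨ ∑-mono (codes d) ψ-lower ⟩
      ∑ (codes d) ψ                                  ≡⟨ ∑-P^ m φ ⟩
      Σψ                                             ∎
    sum-upper : Σψ ≤ E * (L + δ)
    sum-upper = begin
      Σψ                                             ≡⟨ ∑-P^ m φ ⟨
      ∑ (codes d) ψ                                  ≤⟨ ∑-mono (codes d) ψ-upper ⟩
      ∑ (codes d) (λ c → 𝟙 (not (isOdd c)) * (L + δ)) ≡⟨ *-distribʳ-∑ (L + δ) (codes d) _ ⟨
      E * (L + δ)                                    ∎
    double : ∀ e l → (e + e) * l ≡ 2 * (e * l)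
    double = solve-∀
    split : ∀ e l δ → 2 * (e * (l + δ)) ≡ 2 * (e * l) + (e + e) * δ
    split = solve-∀
    upper : d ! * ψ idCode ≤ 2 * Σψ + d ! * δ
    upper = begin
      d ! * ψ idCode                 ≤⟨ *-monoʳ-≤ (d !) (proj₂ (band idCode (id-even {d}))) ⟩
      d ! * (L + δ)                  ≡⟨ cong (_* (L + δ)) evenCodes+evenCodes≡d! ⟨
      (E + E) * (L + δ)              ≡⟨ double E (L + δ) ⟩
      2 * (E * (L + δ))              ≡⟨ split E L δ ⟩
      2 * (E * L) + (E + E) * δ      ≤⟨ +-mono-≤ (*-monoʳ-≤ 2 sum-lower) (≤-reflexive (cong (_* δ) evenCodes+evenCodes≡d!)) ⟩
      2 * Σψ + d ! * δ               ∎
    lower : 2 * Σψ ≤ d ! * ψ idCode + d ! * δ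
    lower = begin
      2 * Σψ                         ≤⟨ *-monoʳ-≤ 2 sum-upper ⟩
      2 * (E * (L + δ))              ≡⟨ split E L δ ⟩
      2 * (E * L) + (E + E) * δ      ≡⟨ cong (_+ (E + E) * δ) (double E L) ⟨
      (E + E) * L + (E + E) * δ      ≡⟨ cong₂ (λ u v → u * L + v * δ) evenCodes+evenCodes≡d! evenCodes+evenCodes≡d! ⟩
      d ! * L + d ! * δ              ≤⟨ +-monoˡ-≤ (d ! * δ) (*-monoʳ-≤ (d !) (proj₁ (band idCode (id-even {d})))) ⟩
      d ! * ψ idCode + d ! * δ       ∎

-- Cycles of a code

walk : ∀ {d} → (Fin d → Fin d) → Fin d → ℕ → Fin d → ℕ → ℕ
walk σ x zero    y k = k
walk σ x (suc f) y k with y ≟ᶠ x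
... | yes _ = k
... | no _  = walk σ x f (σ y) (suc k)

-- walk repeats the local function go of orbitLength, which has no name outside
-- Defs.  The left-hand side of go≡walk is found by unification in its only use;
-- the abstraction over suc d separates the fuel from the dimension.
orbitLength≡walk : ∀ {d} (σ : Fin d → Fin d) x → orbitLength σ x ≡ walk σ x d (σ x) 1
go≡walk : ∀ d (σ : Fin d → Fin d) x f y k → _ ≡ walk σ x f y k

orbitLength≡walk {suc d} σ x with σ x ≟ᶠ x
... | yes _ = refl
... | no _ with suc d | σ | x | σ (σ x) | 2
... | D | σ′ | x′ | y | k = go≡walk D σ′ x′ d y k

go≡walk d σ x zero y k = refl
go≡walk d σ x (suc f) y k with y ≟ᶠ x
... | yes _ = refl
... | no _  = go≡walk d σ x f (σ y) (suc k)

walk-cong : ∀ {d} {σ τ : Fin d → Fin d} → (∀ x → σ x ≡ τ x) → ∀ x f y k → walk σ x f y k ≡ walk τ x f y k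
walk-cong σ≗τ x zero    y k = refl
walk-cong σ≗τ x (suc f) y k with y ≟ᶠ x
... | yes _ = refl
... | no _  rewrite σ≗τ y = walk-cong σ≗τ x f _ (suc k)

orbitLength-cong : ∀ {d} {σ τ : Fin d → Fin d} → (∀ x → σ x ≡ τ x) → ∀ x → orbitLength σ x ≡ orbitLength τ x
orbitLength-cong {d} {σ} {τ} σ≗τ x = begin
  orbitLength σ x       ≡⟨ orbitLength≡walk σ x ⟩
  walk σ x d (σ x) 1    ≡⟨ cong (λ y → walk σ x d y 1) (σ≗τ x) ⟩
  walk σ x d (τ x) 1    ≡⟨ walk-cong σ≗τ x d (τ x) 1 ⟩
  walk τ x d (τ x) 1    ≡⟨ orbitLength≡walk τ x ⟨
  orbitLength τ x       ∎
  where open ≡-Reasoning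

-- Cyclic coordinates for σ: label names the cycle of a point, pos is its place
-- 0, …, top in that cycle, so that the cycle ℓ has suc (top ℓ) points.
record Chart {d n} (σ : Fin d → Fin d) (label : Fin d → Fin n) (pos : Fin d → ℕ) (top : Fin n → ℕ) : Set where
  field
    label-σ   : ∀ x → label (σ x) ≡ label x
    pos≤top   : ∀ x → pos x ≤ top (label x)
    next      : ∀ x → pos (σ x) ≡ suc (pos x) ⊎ (pos x ≡ top (label x) × pos (σ x) ≡ 0)
    injective : ∀ {x y} → label x ≡ label y → pos x ≡ pos y → x ≡ y

module _ {d n} {σ : Fin d → Fin d} {label : Fin d → Fin n} {pos top} (chart : Chart σ label pos top) where
  open Chart chart

  private
    size : Fin d → ℕ
    size x = suc (top (label x))

    -- The coordinates of the point k places after `x` on its cycle: the first alternative has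
    -- wrapped around once, the second not at all.
    Tracks : Fin d → Fin d → ℕ → Set
    Tracks x y k = label y ≡ label x × (pos y + size x ≡ pos x + k ⊎ pos y ≡ pos x + k)

  tracks-start : ∀ x → Tracks x (σ x) 1
  tracks-start x with next x
  ... | inj₁ eq         = label-σ x , inj₂ (trans eq (sym (+-comm (pos x) 1)))
  ... | inj₂ (eq , eq′) = label-σ x , inj₁ (begin
    pos (σ x) + size x ≡⟨ cong (_+ size x) eq′ ⟩
    size x             ≡⟨ cong suc eq ⟨
    suc (pos x)        ≡⟨ +-comm (pos x) 1 ⟨
    pos x + 1          ∎)
    where open ≡-Reasoning

  tracks-step : ∀ x {y k} → k < size x → Tracks x y k → Tracks x (σ y) (suc k)
  tracks-step x {y} {k} k<s (lab , tr) = trans (label-σ y) lab , go (next y) tr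
    where
    go : pos (σ y) ≡ suc (pos y) ⊎ (pos y ≡ top (label y) × pos (σ y) ≡ 0) →
         pos y + size x ≡ pos x + k ⊎ pos y ≡ pos x + k →
         pos (σ y) + size x ≡ pos x + suc k ⊎ pos (σ y) ≡ pos x + suc k
    go (inj₁ p) (inj₁ q) = inj₁ (trans (cong (_+ size x) p) (trans (cong suc q) (sym (+-suc (pos x) k))))
    go (inj₁ p) (inj₂ q) = inj₂ (trans p (trans (cong suc q) (sym (+-suc (pos x) k))))
    -- A second wrap-around would force k to be at least `size x`.
    go (inj₂ (at-top , p)) (inj₁ q) = contradiction q (<⇒≢ too-big ∘ sym)
      where
      too-big : pos x + k < pos y + size x
      too-big = subst (λ a → pos x + k < a + size x) (trans (cong top (sym lab)) (sym at-top)) (+-mono-≤-< (pos≤top x) k<s)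
    go (inj₂ (at-top , p)) (inj₂ q) = inj₁ (begin
      pos (σ y) + size x   ≡⟨ cong (_+ size x) p ⟩
      suc (top (label x))  ≡⟨ cong (suc ∘ top) lab ⟨
      suc (top (label y))  ≡⟨ cong suc (trans (sym at-top) q) ⟩
      suc (pos x + k)      ≡⟨ +-suc (pos x) k ⟨
      pos x + suc k        ∎)
      where open ≡-Reasoning

  tracks-return : ∀ x {k} → 0 < k → Tracks x x k → k ≡ size x
  tracks-return x 0<k (_ , inj₁ eq) = sym (+-cancelˡ-≡ (pos x) _ _ eq)
  tracks-return x 0<k (_ , inj₂ eq) = contradiction (+-cancelˡ-≡ (pos x) 0 _ (trans (+-identityʳ (pos x)) eq)) (<⇒≢ 0<k)

  tracks-end : ∀ x {y} → Tracks x y (size x) → y ≡ x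
  tracks-end x {y} (lab , inj₁ eq) = injective lab (+-cancelʳ-≡ (size x) _ _ eq)
  tracks-end x {y} (lab , inj₂ eq) = contradiction (subst₂ _≤_ eq (cong top lab) (pos≤top y)) (<⇒≱ (m≤n+m (size x) (pos x)))

  -- The walk can stop at `x` only when the counter equals the cycle size. If the fuel runs out
  -- instead, the two bounds on k meet, so the returned counter is correct in either case.
  walk-size : ∀ x f {y k} → Tracks x y k → 0 < k → k ≤ size x → size x ≤ k + f → walk σ x f y k ≡ size x
  walk-size x zero    {y} {k} tr 0<k k≤s s≤ = ≤-antisym k≤s (subst (size x ≤_) (+-identityʳ k) s≤)
  walk-size x (suc f) {y} {k} tr 0<k k≤s s≤ with y ≟ᶠ x
  ... | yes refl = tracks-return x 0<k tr
  ... | no y≢x   = walk-size x f (tracks-step x k<s tr) (s≤s z≤n) k<s (subst (size x ≤_) (+-suc k f) s≤)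
    where
    k<s : k < size x
    k<s = ≤∧≢⇒< k≤s λ { refl → y≢x (tracks-end x tr) }

  orbitLength-chart : ∀ x → size x ≤ suc d → orbitLength σ x ≡ size x
  orbitLength-chart x s≤ = trans (orbitLength≡walk σ x) (walk-size x d (tracks-start x) (s≤s z≤n) (s≤s z≤n) s≤)

-- Charts built by inserting one point at a time.

numCycles : ∀ {d} → Code d → ℕ
numCycles []          = 0
numCycles (zero  ∷ c) = suc (numCycles c)
numCycles (suc j ∷ c) = numCycles c

label : ∀ {d} (c : Code d) → Fin d → Fin (numCycles c)
label (zero  ∷ c) zero    = zero
label (zero  ∷ c) (suc x) = suc (label c x)
label (suc j ∷ c) zero    = label c j
label (suc j ∷ c) (suc x) = label c x

top : ∀ {d} (c : Code d) → Fin (numCycles c) → ℕ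
top (zero  ∷ c) zero    = 0
top (zero  ∷ c) (suc l) = top c l
top (suc j ∷ c) l       = 𝟙 (does (l ≟ᶠ label c j)) + top c l

-- The code suc j ∷ c inserts the point 0 into the cycle of j, just before j.
pos : ∀ {d} (c : Code d) → Fin d → ℕ
pos (zero  ∷ c) zero    = 0
pos (zero  ∷ c) (suc x) = pos c x
pos (suc j ∷ c) zero    = pos c j
pos (suc j ∷ c) (suc x) with label c x ≟ᶠ label c j | pos c j ≤? pos c x
... | yes _ | yes _ = suc (pos c x)
... | yes _ | no _  = pos c x
... | no _  | _     = pos c x

top<d : ∀ {d} (c : Code d) l → top c l < d
top<d (zero  ∷ c) zero    = s≤s z≤n
top<d (zero  ∷ c) (suc l) = m<n⇒m<1+n (top<d c l)
top<d (suc j ∷ c) l       = s≤s (≤-trans (+-monoˡ-≤ (top c l) (𝟙≤1 (does (l ≟ᶠ label c j)))) (top<d c l))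

module Insertion {d} (j : Fin d) (c : Code d) (ih : Chart (eval c) (label c) (pos c) (top c)) where
  open Chart ih

  private
    σ = eval (suc j ∷ c)
    pos⁺ = pos (suc j ∷ c)
    top⁺ = top (suc j ∷ c)

  -- How the insertion affects an old point: in the cycle of `j`, points from `j` onwards shift by
  -- one and earlier ones stay; other cycles are untouched. Each case carries the equations that it
  -- makes true.
  data Position (x : Fin d) : Set where
    after  : label c x ≡ label c j → pos c j ≤ pos c x → pos⁺ (suc x) ≡ suc (pos c x) →
             top⁺ (label c x) ≡ suc (top c (label c x)) → Position x
    before : label c x ≡ label c j → pos c x < pos c j → pos⁺ (suc x) ≡ pos c x →
             top⁺ (label c x) ≡ suc (top c (label c x)) → Position x
    apart  : label c x ≢ label c j → pos⁺ (suc x) ≡ pos c x →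
             top⁺ (label c x) ≡ top c (label c x) → Position x

  position : ∀ x → Position x
  position x with label c x ≟ᶠ label c j in eq₁ | pos c j ≤? pos c x in eq₂
  ... | yes p | yes q = after p q pos≡ top≡
    where
    pos≡ : pos⁺ (suc x) ≡ suc (pos c x)
    pos≡ rewrite eq₁ | eq₂ = refl
    top≡ : top⁺ (label c x) ≡ suc (top c (label c x))
    top≡ rewrite eq₁ = refl
  ... | yes p | no ¬q = before p (≰⇒> ¬q) pos≡ top≡
    where
    pos≡ : pos⁺ (suc x) ≡ pos c x
    pos≡ rewrite eq₁ | eq₂ = refl
    top≡ : top⁺ (label c x) ≡ suc (top c (label c x))
    top≡ rewrite eq₁ = refl
  ... | no ¬p | _ = apart ¬p pos≡ top≡
    where
    pos≡ : pos⁺ (suc x) ≡ pos c x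
    pos≡ rewrite eq₁ = refl
    top≡ : top⁺ (label c x) ≡ top c (label c x)
    top≡ rewrite eq₁ = refl

  top≤top⁺ : ∀ l → top c l ≤ top⁺ l
  top≤top⁺ l = m≤n+m (top c l) _

  label-σ⁺ : ∀ x → label (suc j ∷ c) (σ x) ≡ label (suc j ∷ c) x
  label-σ⁺ zero = refl
  label-σ⁺ (suc x) with eval c x ≟ᶠ j
  ... | yes refl = label-σ x
  ... | no _     = label-σ x

  pos≤top⁺ : ∀ x → pos⁺ x ≤ top⁺ (label (suc j ∷ c) x)
  pos≤top⁺ zero = ≤-trans (pos≤top j) (top≤top⁺ (label c j))
  pos≤top⁺ (suc x) with position x
  ... | after _ _ p t  = subst₂ _≤_ (sym p) (sym t) (s≤s (pos≤top x))
  ... | before _ _ p t = subst₂ _≤_ (sym p) (sym t) (m≤n⇒m≤1+n (pos≤top x))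
  ... | apart _ p t    = subst₂ _≤_ (sym p) (sym t) (pos≤top x)

  -- Here `x` keeps its successor. The two positions shift alike unless the step crosses the
  -- insertion point from before to after, which would mean landing on `j`, or the step wraps
  -- around; in the cycle of `j` a wrap starts from a shifted point, because no point before `j` can
  -- be at the top.
  next-apart : ∀ x → eval c x ≢ j →
    pos⁺ (suc (eval c x)) ≡ suc (pos⁺ (suc x)) ⊎ (pos⁺ (suc x) ≡ top⁺ (label c x) × pos⁺ (suc (eval c x)) ≡ 0)
  next-apart x y≢j with position x | position (eval c x) | next x
  ... | after _ _ p _  | after _ _ q _  | inj₁ n = inj₁ (trans q (trans (cong suc n) (cong suc (sym p))))
  ... | after _ a p _  | before _ b q _ | inj₁ n = contradiction (≤-trans a (≤-trans (n≤1+n _) (≤-reflexive (sym n)))) (<⇒≱ b)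
  ... | after l _ _ _  | apart ¬l _ _   | _      = contradiction (trans (label-σ x) l) ¬l
  ... | before l a p _ | after l′ b q _ | inj₁ n =
    contradiction (injective l′ (≤-antisym (≤-trans (≤-reflexive n) a) b)) y≢j
  ... | before _ _ p _ | before _ _ q _ | inj₁ n = inj₁ (trans q (trans n (cong suc (sym p))))
  ... | before l _ _ _ | apart ¬l _ _   | _      = contradiction (trans (label-σ x) l) ¬l
  ... | apart ¬l _ _   | after l _ _ _  | _      = contradiction (trans (sym (label-σ x)) l) ¬l
  ... | apart ¬l _ _   | before l _ _ _ | _      = contradiction (trans (sym (label-σ x)) l) ¬l
  ... | apart _ p _    | apart _ q _    | inj₁ n = inj₁ (trans q (trans n (cong suc (sym p))))
  ... | apart _ p t    | apart _ q _    | inj₂ (m , n) = inj₂ (trans p (trans m (sym t)) , trans q n)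
  ... | after _ _ p t  | before _ _ q _ | inj₂ (m , n) = inj₂ (trans p (trans (cong suc m) (sym t)) , trans q n)
  ... | after _ _ _ _  | after l b _ _  | inj₂ (m , n) =
    contradiction (injective l (trans n (sym (n≤0⇒n≡0 (subst (pos c j ≤_) n b))))) y≢j
  ... | before l a _ _ | after _ _ _ _  | inj₂ (m , n) =
    contradiction (subst₂ _≤_ refl (trans (cong (top c) (sym l)) (sym m)) (pos≤top j)) (<⇒≱ a)
  ... | before l a _ _ | before _ _ _ _ | inj₂ (m , n) =
    contradiction (subst₂ _≤_ refl (trans (cong (top c) (sym l)) (sym m)) (pos≤top j)) (<⇒≱ a)

  -- The old predecessor of `j` now maps to the new point, whose position is the old `pos c j`.
  next-hit : ∀ x → eval c x ≡ j →
    pos c j ≡ suc (pos⁺ (suc x)) ⊎ (pos⁺ (suc x) ≡ top⁺ (label c x) × pos c j ≡ 0)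
  next-hit x refl with position x | next x
  ... | after _ a _ _  | inj₁ n       = contradiction (≤-reflexive (sym n)) (≤⇒≯ a)
  ... | after _ _ p t  | inj₂ (m , n) = inj₂ (trans p (trans (cong suc m) (sym t)) , n)
  ... | before _ _ p _ | inj₁ n       = inj₁ (trans n (cong suc (sym p)))
  ... | before _ a _ _ | inj₂ (m , n) = contradiction (subst (pos c x <_) n a) λ ()
  ... | apart ¬l _ _   | _            = contradiction (sym (label-σ x)) ¬l

  next⁺ : ∀ x → pos⁺ (σ x) ≡ suc (pos⁺ x) ⊎ (pos⁺ x ≡ top⁺ (label (suc j ∷ c) x) × pos⁺ (σ x) ≡ 0)
  next⁺ zero with position j
  ... | after _ _ p _  = inj₁ p
  ... | before _ a _ _ = contradiction a (<-irrefl refl)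
  ... | apart ¬l _ _   = contradiction refl ¬l
  next⁺ (suc x) with eval c x ≟ᶠ j
  ... | yes y≡j = next-hit x y≡j
  ... | no y≢j  = next-apart x y≢j

  zero-alone : ∀ y → label c j ≡ label c y → pos c j ≢ pos⁺ (suc y)
  zero-alone y l eq with position y
  ... | after _ a p _  = contradiction (≤-reflexive (sym (trans eq p))) (≤⇒≯ a)
  ... | before _ a p _ = contradiction (trans eq p) (<⇒≢ a ∘ sym)
  ... | apart ¬l _ _   = contradiction (sym l) ¬l

  injective⁺ : ∀ {x y} → label (suc j ∷ c) x ≡ label (suc j ∷ c) y → pos⁺ x ≡ pos⁺ y → x ≡ y
  injective⁺ {zero}  {zero}  _ _  = refl
  injective⁺ {zero}  {suc y} l eq = contradiction eq (zero-alone y l)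
  injective⁺ {suc x} {zero}  l eq = contradiction (sym eq) (zero-alone x (sym l))
  injective⁺ {suc x} {suc y} l eq with position x | position y
  ... | after _ _ p _   | after _ _ q _  = cong suc (injective l (suc-injective (trans (sym p) (trans eq q))))
  ... | after _ a p _   | before _ b q _ = contradiction (trans (sym p) (trans eq q)) (>⇒≢ (<-≤-trans b (m≤n⇒m≤1+n a)))
  ... | after k _ _ _   | apart ¬k _ _   = contradiction (trans (sym l) k) ¬k
  ... | before _ a p _  | after _ b q _  = contradiction (trans (sym p) (trans eq q)) (<⇒≢ (<-≤-trans a (m≤n⇒m≤1+n b)))
  ... | before _ _ p _  | before _ _ q _ = cong suc (injective l (trans (sym p) (trans eq q)))
  ... | before k _ _ _  | apart ¬k _ _   = contradiction (trans (sym l) k) ¬k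
  ... | apart ¬k _ _    | after k _ _ _  = contradiction (trans l k) ¬k
  ... | apart ¬k _ _    | before k _ _ _ = contradiction (trans l k) ¬k
  ... | apart _ p _     | apart _ q _    = cong suc (injective l (trans (sym p) (trans eq q)))

chart : ∀ {d} (c : Code d) → Chart (eval c) (label c) (pos c) (top c)
chart [] = record { label-σ = λ () ; pos≤top = λ () ; next = λ () ; injective = λ { {()} } }
chart (zero ∷ c) = record
  { label-σ   = λ { zero → refl ; (suc x) → cong suc (label-σ x) }
  ; pos≤top   = λ { zero → z≤n ; (suc x) → pos≤top x }
  ; next      = λ { zero → inj₂ (refl , refl) ; (suc x) → next x }
  ; injective = λ { {zero} {zero} _ _ → refl ; {suc x} {suc y} l p → cong suc (injective (sucᶠ-injective l) p) }
  }
  where open Chart (chart c)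
chart (suc j ∷ c) = record { label-σ = label-σ⁺ ; pos≤top = pos≤top⁺ ; next = next⁺ ; injective = injective⁺ }
  where open Insertion j c (chart c)

orbitLength-eval : ∀ {d} (c : Code d) x → orbitLength (eval c) x ≡ suc (top c (label c x))
orbitLength-eval c x = orbitLength-chart (chart c) x (m≤n⇒m≤1+n (top<d c (label c x)))

-- Sizes of conjugacy classes

∏ : ∀ {A : Set} → List A → (A → ℕ) → ℕ
∏ xs f = product (map f xs)

∏-upTo-suc : ∀ n (f : ℕ → ℕ) → ∏ (upTo (suc n)) f ≡ f 0 * ∏ (upTo n) (f ∘ suc)
∏-upTo-suc n f =
  cong (f 0 *_) (trans (cong product (map-applyUpTo suc f n)) (sym (cong product (map-applyUpTo (λ i → i) (f ∘ suc) n))))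

∏-cong : ∀ {A : Set} (xs : List A) {f g : A → ℕ} → (∀ x → f x ≡ g x) → ∏ xs f ≡ ∏ xs g
∏-cong xs f≗g = cong product (map-cong f≗g xs)

∏-distrib-* : ∀ {A : Set} (xs : List A) (f g : A → ℕ) → ∏ xs (λ x → f x * g x) ≡ ∏ xs f * ∏ xs g
∏-distrib-* []       f g = refl
∏-distrib-* (x ∷ xs) f g rewrite ∏-distrib-* xs f g = rearrange (f x) (g x) (∏ xs f) (∏ xs g)
  where
  rearrange : ∀ a b c d → a * b * (c * d) ≡ a * c * (b * d)
  rearrange = solve-∀

map-upTo-cong : ∀ n {f g : ℕ → ℕ} → (∀ {k} → k < n → f k ≡ g k) → map f (upTo n) ≡ map g (upTo n)
map-upTo-cong n {f} {g} eq = trans (map-applyUpTo (λ i → i) f n) (trans (go n eq) (sym (map-applyUpTo (λ i → i) g n)))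
  where
  go : ∀ n {f g : ℕ → ℕ} → (∀ {k} → k < n → f k ≡ g k) → applyUpTo f n ≡ applyUpTo g n
  go zero    eq = refl
  go (suc n) eq = cong₂ _∷_ (eq (s≤s z≤n)) (go n (λ k<n → eq (s≤s k<n)))

∑-upTo-update : ∀ D {k} → k < D → ∀ (f g : ℕ → ℕ) u → (∀ j → j ≢ k → g j ≡ f j) → g k ≡ f k + u →
                ∑ (upTo D) g ≡ ∑ (upTo D) f + u
∑-upTo-update (suc D) {zero} _ f g u off at = begin
  ∑ (upTo (suc D)) g                     ≡⟨ ∑-upTo-suc D g ⟩
  g 0 + ∑ (upTo D) (g ∘ suc)             ≡⟨ cong₂ _+_ at (∑-cong (upTo D) (λ j → off (suc j) λ ())) ⟩
  f 0 + u + ∑ (upTo D) (f ∘ suc)         ≡⟨ rearrange (f 0) u _ ⟩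
  f 0 + ∑ (upTo D) (f ∘ suc) + u         ≡⟨ cong (_+ u) (∑-upTo-suc D f) ⟨
  ∑ (upTo (suc D)) f + u                 ∎
  where
  open ≡-Reasoning
  rearrange : ∀ a b c → a + b + c ≡ a + c + b
  rearrange = solve-∀
∑-upTo-update (suc D) {suc k} (s≤s k<D) f g u off at = begin
  ∑ (upTo (suc D)) g                     ≡⟨ ∑-upTo-suc D g ⟩
  g 0 + ∑ (upTo D) (g ∘ suc)             ≡⟨ cong₂ _+_ (off 0 λ ()) (∑-upTo-update D k<D (f ∘ suc) (g ∘ suc) u
                                              (λ j j≢k → off (suc j) (j≢k ∘ suc-injective)) at) ⟩
  f 0 + (∑ (upTo D) (f ∘ suc) + u)       ≡⟨ +-assoc (f 0) _ u ⟨
  f 0 + ∑ (upTo D) (f ∘ suc) + u         ≡⟨ cong (_+ u) (∑-upTo-suc D f) ⟨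
  ∑ (upTo (suc D)) f + u                 ∎
  where open ≡-Reasoning

∏-upTo-update : ∀ D {k} → k < D → ∀ (f g : ℕ → ℕ) u → (∀ j → j ≢ k → g j ≡ f j) → g k ≡ f k * u →
                ∏ (upTo D) g ≡ ∏ (upTo D) f * u
∏-upTo-update (suc D) {zero} _ f g u off at = begin
  ∏ (upTo (suc D)) g                     ≡⟨ ∏-upTo-suc D g ⟩
  g 0 * ∏ (upTo D) (g ∘ suc)             ≡⟨ cong₂ _*_ at (∏-cong (upTo D) (λ j → off (suc j) λ ())) ⟩
  f 0 * u * ∏ (upTo D) (f ∘ suc)         ≡⟨ rearrange (f 0) u _ ⟩
  f 0 * ∏ (upTo D) (f ∘ suc) * u         ≡⟨ cong (_* u) (∏-upTo-suc D f) ⟨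
  ∏ (upTo (suc D)) f * u                 ∎
  where
  open ≡-Reasoning
  rearrange : ∀ a b c → a * b * c ≡ a * c * b
  rearrange = solve-∀
∏-upTo-update (suc D) {suc k} (s≤s k<D) f g u off at = begin
  ∏ (upTo (suc D)) g                     ≡⟨ ∏-upTo-suc D g ⟩
  g 0 * ∏ (upTo D) (g ∘ suc)             ≡⟨ cong₂ _*_ (off 0 λ ()) (∏-upTo-update D k<D (f ∘ suc) (g ∘ suc) u
                                              (λ j j≢k → off (suc j) (j≢k ∘ suc-injective)) at) ⟩
  f 0 * (∏ (upTo D) (f ∘ suc) * u)       ≡⟨ *-assoc (f 0) _ u ⟨
  f 0 * ∏ (upTo D) (f ∘ suc) * u         ≡⟨ cong (_* u) (∏-upTo-suc D f) ⟨
  ∏ (upTo (suc D)) f * u                 ∎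
  where open ≡-Reasoning

∑-upTo-δ : ∀ D {k} → k < D → (f : ℕ → ℕ) → ∑ (upTo D) (λ j → 𝟙 (does (k ≟ j)) * f j) ≡ f k
∑-upTo-δ D {k} k<D f = trans
  (∑-upTo-update D k<D (λ _ → 0) _ (f k) (λ j j≢k → cong (_* f j) (𝟙-no (k ≟ j) (j≢k ∘ sym)))
    (trans (cong (_* f k) (𝟙-yes (k ≟ k) refl)) (*-identityˡ (f k))))
  (cong (_+ f k) (∑-zero (upTo D) (λ _ → refl)))

-- A cycle type is given by its multiplicities: a k is the number of cycles with suc k points.
δ : ℕ → ℕ → ℕ
δ k j = 𝟙 (does (k ≟ j))

inc : ℕ → (ℕ → ℕ) → ℕ → ℕ
inc k a j = δ k j + a j

inc-at : ∀ k a → inc k a k ≡ suc (a k)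
inc-at k a = cong (_+ a k) (𝟙-yes (k ≟ k) refl)

inc-off : ∀ {k j} a → k ≢ j → inc k a j ≡ a j
inc-off {k} {j} a k≢j = cong (_+ a j) (𝟙-no (k ≟ j) k≢j)

weight : ℕ → (ℕ → ℕ) → ℕ
weight D a = ∑ (upTo D) (λ k → suc k * a k)

-- The order of the centralizer of a permutation of this type: a rotation of each cycle together
-- with a permutation of the cycles of equal size.
centralizer : ℕ → (ℕ → ℕ) → ℕ
centralizer D a = ∏ (upTo D) (λ k → suc k ^ a k * a k !)

weight-inc : ∀ D {k} → k < D → ∀ a → weight D (inc k a) ≡ weight D a + suc k
weight-inc D {k} k<D a = ∑-upTo-update D k<D _ _ (suc k)
  (λ j j≢k → cong (suc j *_) (inc-off a (j≢k ∘ sym)))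
  (trans (cong (suc k *_) (inc-at k a)) (trans (*-suc (suc k) (a k)) (+-comm (suc k) _)))

centralizer-inc : ∀ D {k} → k < D → ∀ a → centralizer D (inc k a) ≡ centralizer D a * (suc k * suc (a k))
centralizer-inc D {k} k<D a = ∏-upTo-update D k<D _ _ (suc k * suc (a k))
  (λ j j≢k → cong (λ n → suc j ^ n * n !) (inc-off a (j≢k ∘ sym)))
  (trans (cong (λ n → suc k ^ n * n !) (inc-at k a)) (rearrange (suc k) (suc k ^ a k) (suc (a k)) (a k !)))
  where
  rearrange : ∀ s p t f → s * p * (t * f) ≡ p * f * (s * t)
  rearrange = solve-∀

weight-cong : ∀ D {a b} → (∀ k → a k ≡ b k) → weight D a ≡ weight D b
weight-cong D a≗b = ∑-cong (upTo D) (λ k → cong (suc k *_) (a≗b k))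

centralizer-cong : ∀ D {a b} → (∀ k → a k ≡ b k) → centralizer D a ≡ centralizer D b
centralizer-cong D a≗b = ∏-cong (upTo D) (λ k → cong (λ n → suc k ^ n * n !) (a≗b k))

-- Removes one cycle with suc k points. The equation holds pointwise only, and is carried into
-- weights and centralizers by `weight-cong` and `centralizer-cong`.
dec : ∀ k (a : ℕ → ℕ) → a k ≢ 0 → ∃[ b ] (∀ j → a j ≡ inc k b j)
dec k a ak≢0 = (λ j → a j ∸ δ k j) , λ j → sym (m+[n∸m]≡n (δ≤a j))
  where
  δ≤a : ∀ j → δ k j ≤ a j
  δ≤a j with k ≟ j
  ... | no k≢j   = subst (_≤ a j) (sym (𝟙-no (k ≟ j) k≢j)) z≤n
  ... | yes refl = ≤-trans (𝟙≤1 (does (k ≟ k))) (n≢0⇒n>0 ak≢0)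

weight≡0 : ∀ D {a} → weight D a ≡ 0 → ∀ {k} → k < D → a k ≡ 0
weight≡0 D {a} w≡0 {k} k<D with a k ≟ 0
... | yes p = p
... | no ¬p with b , a≗ ← dec k a ¬p =
  contradiction (trans (sym w≡0) (trans (weight-cong D a≗) (trans (weight-inc D k<D b) (+-suc _ k)))) λ ()

centralizer-zero : ∀ D → centralizer D (λ _ → 0) ≡ 1
centralizer-zero zero    = refl
centralizer-zero (suc D) =
  trans (∏-upTo-suc D (λ k → suc k ^ 0 * 0 !)) (trans (+-identityʳ _) (centralizer-zero D))

eqBelow? : ∀ D (a b : ℕ → ℕ) → Dec (∀ {k} → k < D → a k ≡ b k)
eqBelow? D a b = allUpTo? (λ k → a k ≟ b k) D

mult : ∀ {d} → Code d → ℕ → ℕ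
mult c k = ∑ (allFin (numCycles c)) (λ l → δ (top c l) k)

mult-zero∷ : ∀ {d} (c : Code d) k → mult (zero ∷ c) k ≡ inc 0 (mult c) k
mult-zero∷ c k = ∑-allFin-suc (numCycles c) (λ l → δ (top (zero ∷ c) l) k)

∑-allFin-update : ∀ {n} (i : Fin n) (f g : Fin n → ℕ) u v → (∀ j → j ≢ i → g j ≡ f j) → g i + v ≡ f i + u →
                  ∑ (allFin n) g + v ≡ ∑ (allFin n) f + u
∑-allFin-update {suc n} zero f g u v off at = begin
  ∑ (allFin (suc n)) g + v               ≡⟨ cong (_+ v) (∑-allFin-suc n g) ⟩
  g zero + ∑ (allFin n) (g ∘ suc) + v    ≡⟨ cong (λ s → g zero + s + v) (∑-cong (allFin n) (λ j → off (suc j) λ ())) ⟩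
  g zero + ∑ (allFin n) (f ∘ suc) + v    ≡⟨ rearrange (g zero) _ v ⟩
  g zero + v + ∑ (allFin n) (f ∘ suc)    ≡⟨ cong (_+ ∑ (allFin n) (f ∘ suc)) at ⟩
  f zero + u + ∑ (allFin n) (f ∘ suc)    ≡⟨ rearrange (f zero) u _ ⟩
  f zero + ∑ (allFin n) (f ∘ suc) + u    ≡⟨ cong (_+ u) (∑-allFin-suc n f) ⟨
  ∑ (allFin (suc n)) f + u               ∎
  where
  open ≡-Reasoning
  rearrange : ∀ a b c → a + b + c ≡ a + c + b
  rearrange = solve-∀
∑-allFin-update {suc n} (suc i) f g u v off at = begin
  ∑ (allFin (suc n)) g + v               ≡⟨ cong (_+ v) (∑-allFin-suc n g) ⟩
  g zero + ∑ (allFin n) (g ∘ suc) + v    ≡⟨ +-assoc (g zero) _ v ⟩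
  g zero + (∑ (allFin n) (g ∘ suc) + v)  ≡⟨ cong₂ _+_ (off zero λ ()) (∑-allFin-update i (f ∘ suc) (g ∘ suc) u v
                                              (λ j j≢i → off (suc j) (j≢i ∘ sucᶠ-injective)) at) ⟩
  f zero + (∑ (allFin n) (f ∘ suc) + u)  ≡⟨ +-assoc (f zero) _ u ⟨
  f zero + ∑ (allFin n) (f ∘ suc) + u    ≡⟨ cong (_+ u) (∑-allFin-suc n f) ⟨
  ∑ (allFin (suc n)) f + u               ∎
  where open ≡-Reasoning

-- One cycle with suc h points is traded for one with a point more; the lost cycle is added back on
-- the left.
mult-suc∷ : ∀ {d} j (c : Code d) k → let h = top c (label c j) in
            mult (suc j ∷ c) k + δ h k ≡ mult c k + δ (suc h) k
mult-suc∷ j c k = ∑-allFin-update (label c j) (λ l → δ (top c l) k) (λ l → δ (top (suc j ∷ c) l) k)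
  (δ (suc h) k) (δ h k)
  (λ l l≢ → cong (λ e → δ (e + top c l) k) (𝟙-no (l ≟ᶠ label c j) l≢))
  (trans (cong (λ e → δ (e + h) k + δ h k) (𝟙-yes (label c j ≟ᶠ label c j) refl)) (+-comm (δ (suc h) k) (δ h k)))
  where h = top c (label c j)

∑-label : ∀ {d} (c : Code d) (g : Fin (numCycles c) → ℕ) →
          ∑ (allFin d) (g ∘ label c) ≡ ∑ (allFin (numCycles c)) (λ l → suc (top c l) * g l)
∑-label [] g = refl
∑-label {suc d} (zero ∷ c) g = begin
  ∑ (allFin (suc d)) (g ∘ label (zero ∷ c))            ≡⟨ ∑-allFin-suc d _ ⟩
  g zero + ∑ (allFin d) (g ∘ suc ∘ label c)            ≡⟨ cong₂ _+_ (sym (+-identityʳ (g zero))) (∑-label c (g ∘ suc)) ⟩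
  1 * g zero + ∑ (allFin (numCycles c)) (λ l → suc (top c l) * g (suc l)) ≡⟨ ∑-allFin-suc (numCycles c) _ ⟨
  ∑ (allFin (suc (numCycles c))) (λ l → suc (top (zero ∷ c) l) * g l) ∎
  where open ≡-Reasoning
∑-label {suc d} (suc j ∷ c) g = begin
  ∑ (allFin (suc d)) (g ∘ label (suc j ∷ c))           ≡⟨ ∑-allFin-suc d _ ⟩
  g (label c j) + ∑ (allFin d) (g ∘ label c)           ≡⟨ cong₂ _+_ (sym (∑-allFin-δ (label c j) g)) (∑-label c g) ⟩
  ∑ L (λ l → e l * g l) + ∑ L (λ l → suc (top c l) * g l)  ≡⟨ ∑-distrib-+ L _ _ ⟨
  ∑ L (λ l → e l * g l + suc (top c l) * g l)          ≡⟨ ∑-cong L (λ l → rearrange (e l) (top c l) (g l)) ⟩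
  ∑ L (λ l → suc (e l + top c l) * g l)                ∎
  where
  open ≡-Reasoning
  L = allFin (numCycles c)
  e : Fin (numCycles c) → ℕ
  e l = 𝟙 (does (l ≟ᶠ label c j))
  rearrange : ∀ e t g → e * g + suc t * g ≡ suc (e + t) * g
  rearrange = solve-∀

∑-top : ∀ {d} (c : Code d) {D} → d ≤ D → (g : ℕ → ℕ) →
        ∑ (allFin (numCycles c)) (g ∘ top c) ≡ ∑ (upTo D) (λ k → mult c k * g k)
∑-top c {D} d≤D g = begin
  ∑ L (g ∘ top c)                                  ≡⟨ ∑-cong L (λ l → ∑-upTo-δ D (<-≤-trans (top<d c l) d≤D) g) ⟨
  ∑ L (λ l → ∑ (upTo D) (λ k → δ (top c l) k * g k)) ≡⟨ ∑-comm L (upTo D) _ ⟩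
  ∑ (upTo D) (λ k → ∑ L (λ l → δ (top c l) k * g k)) ≡⟨ ∑-cong (upTo D) (λ k → *-distribʳ-∑ (g k) L _) ⟨
  ∑ (upTo D) (λ k → mult c k * g k)                ∎
  where
  open ≡-Reasoning
  L = allFin (numCycles c)

-- The bound D on cycle sizes stays fixed while d grows in the induction, so that weights and
-- centralizers range over the same indices. For k below `D′` the index suc k of an enlarged cycle
-- is still below D.
module Count (D′ : ℕ) where
  private
    D = suc D′

  χ : ∀ {d} → (ℕ → ℕ) → Code d → ℕ
  χ a c = 𝟙 (does (eqBelow? D (mult c) a))

  χ-⇔ : ∀ {d e} {a b : ℕ → ℕ} {c : Code d} {c′ : Code e} →
        (∀ {k} → k < D → mult c k ≡ a k → mult c′ k ≡ b k) →
        (∀ {k} → k < D → mult c′ k ≡ b k → mult c k ≡ a k) → χ a c ≡ χ b c′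
  χ-⇔ f g = 𝟙-cong (eqBelow? D _ _) (eqBelow? D _ _) (λ h k<D → f k<D (h k<D)) (λ h k<D → g k<D (h k<D))

  -- Inserting 0 into a cycle with suc k points yields cycle type a; both sides are
  -- incremented so that no subtraction occurs.
  ξ : ∀ {d} → (ℕ → ℕ) → ℕ → Code d → ℕ
  ξ a k c = 𝟙 (does (eqBelow? D (inc (suc k) (mult c)) (inc k a)))

  χ-suc∷ : ∀ {d} a j (c : Code d) → χ a (suc j ∷ c) ≡ ξ a (top c (label c j)) c
  χ-suc∷ a j c = 𝟙-cong (eqBelow? D _ _) (eqBelow? D _ _)
    (λ eq {k} k<D → trans (+-comm (δ (suc h) k) (mult c k)) (trans (sym (mult-suc∷ j c k))
      (trans (cong (_+ δ h k) (eq k<D)) (+-comm (a k) (δ h k)))))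
    (λ eq {k} k<D → +-cancelʳ-≡ (δ h k) _ _ (trans (mult-suc∷ j c k) (trans (+-comm (mult c k) (δ (suc h) k))
      (trans (eq k<D) (+-comm (δ h k) (a k))))))
    where h = top c (label c j)

  -- Codes are sorted by leading digit. Digit zero adds a fixed point; a nonzero digit matters only
  -- through the size of the cycle it names, and `suc k * mult c k` digits name a point in a cycle
  -- with suc k points.
  ∑-χ-suc : ∀ {d} → d ≤ D′ → ∀ a → ∑ (codes (suc d)) (χ a) ≡
            ∑ (codes d) (λ c → χ a (zero ∷ c)) + ∑ (upTo D′) (λ k → ∑ (codes d) (λ c → suc k * mult c k * ξ a k c))
  ∑-χ-suc {d} d≤D′ a = begin
    ∑ (codes (suc d)) (χ a)
      ≡⟨ ∑-codes-suc d (χ a) ⟩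
    ∑ (allFin (suc d)) (λ i → ∑ (codes d) (λ c → χ a (i ∷ c)))
      ≡⟨ ∑-allFin-suc d _ ⟩
    ∑ (codes d) (λ c → χ a (zero ∷ c)) + ∑ (allFin d) (λ j → ∑ (codes d) (λ c → χ a (suc j ∷ c)))
      ≡⟨ cong (∑ (codes d) (λ c → χ a (zero ∷ c)) +_) (trans (∑-comm (allFin d) (codes d) _)
           (trans (∑-cong (codes d) insertions) (∑-comm (codes d) (upTo D′) _))) ⟩
    ∑ (codes d) (λ c → χ a (zero ∷ c)) + ∑ (upTo D′) (λ k → ∑ (codes d) (λ c → suc k * mult c k * ξ a k c)) ∎
    where
    open ≡-Reasoning
    rearrange : ∀ m s x → m * (s * x) ≡ s * m * x
    rearrange = solve-∀
    insertions : ∀ c → ∑ (allFin d) (λ j → χ a (suc j ∷ c)) ≡ ∑ (upTo D′) (λ k → suc k * mult c k * ξ a k c)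
    insertions c = begin
      ∑ (allFin d) (λ j → χ a (suc j ∷ c))                    ≡⟨ ∑-cong (allFin d) (λ j → χ-suc∷ a j c) ⟩
      ∑ (allFin d) (λ j → ξ a (top c (label c j)) c)          ≡⟨ ∑-label c (λ l → ξ a (top c l) c) ⟩
      ∑ (allFin (numCycles c)) (λ l → suc (top c l) * ξ a (top c l) c) ≡⟨ ∑-top c d≤D′ (λ k → suc k * ξ a k c) ⟩
      ∑ (upTo D′) (λ k → mult c k * (suc k * ξ a k c))
        ≡⟨ ∑-cong (upTo D′) (λ k → rearrange (mult c k) (suc k) (ξ a k c)) ⟩
      ∑ (upTo D′) (λ k → suc k * mult c k * ξ a k c)          ∎

  ClassSize : ℕ → Set
  ClassSize d = ∀ a → weight D a ≡ d → centralizer D a * ∑ (codes d) (χ a) ≡ d !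

  -- Deleting the fixed point 0 leaves a type b with one fixed point fewer, and the centralizer
  -- order of a is a 0 times that of b.
  fixed-point-term : ∀ {d} → ClassSize d → ∀ a → weight D a ≡ suc d →
                     centralizer D a * ∑ (codes d) (λ c → χ a (zero ∷ c)) ≡ a 0 * d !
  fixed-point-term {d} ih a w with a 0 ≟ 0
  ... | yes a₀≡0 = begin
    centralizer D a * ∑ (codes d) (λ c → χ a (zero ∷ c))  ≡⟨ cong (centralizer D a *_) (∑-zero (codes d) absent) ⟩
    centralizer D a * 0                                   ≡⟨ *-zeroʳ (centralizer D a) ⟩
    0 * d !                                               ≡⟨ cong (_* d !) a₀≡0 ⟨
    a 0 * d !                                             ∎
    where
    open ≡-Reasoning
    absent : ∀ c → χ a (zero ∷ c) ≡ 0
    absent c = 𝟙-no (eqBelow? D (mult (zero ∷ c)) a) λ eq →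
      contradiction (trans (sym (trans (mult-zero∷ c 0) (inc-at 0 (mult c)))) (trans (eq (s≤s z≤n)) a₀≡0)) λ ()
  ... | no a₀≢0 with b , a≗ ← dec 0 a a₀≢0 = begin
    centralizer D a * ∑ (codes d) (λ c → χ a (zero ∷ c))
      ≡⟨ cong₂ _*_ (trans (centralizer-cong D a≗) (centralizer-inc D (s≤s z≤n) b)) (∑-cong (codes d) χ-zero∷) ⟩
    centralizer D b * (1 * suc (b 0)) * ∑ (codes d) (χ b)
      ≡⟨ rearrange (centralizer D b) (suc (b 0)) _ ⟩
    suc (b 0) * (centralizer D b * ∑ (codes d) (χ b))
      ≡⟨ cong₂ _*_ (sym (trans (a≗ 0) (inc-at 0 b))) (ih b weight-b) ⟩
    a 0 * d ! ∎
    where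
    open ≡-Reasoning
    rearrange : ∀ x y z → x * (1 * y) * z ≡ y * (x * z)
    rearrange = solve-∀
    weight-b : weight D b ≡ d
    weight-b = suc-injective (trans (sym (trans (weight-inc D (s≤s z≤n) b) (+-comm _ 1)))
      (trans (sym (weight-cong D a≗)) w))
    χ-zero∷ : ∀ c → χ a (zero ∷ c) ≡ χ b c
    χ-zero∷ c = χ-⇔ {c = zero ∷ c} {c′ = c}
      (λ {k} _ eq → +-cancelˡ-≡ (δ 0 k) _ _ (trans (sym (mult-zero∷ c k)) (trans eq (a≗ k))))
      (λ {k} _ eq → trans (mult-zero∷ c k) (trans (cong (δ 0 k +_) eq) (sym (a≗ k))))

  -- If 0 lies in a cycle with k + 2 points, deleting it replaces that cycle by one with k + 1
  -- points. The types before and after share a common part b with one cycle removed, and their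
  -- centralizer orders differ from that of b by (k + 2) * a (k + 1) and (k + 1) * (b k + 1); the
  -- latter factor is also the number of ways to insert 0.
  insertion-term : ∀ {d} → ClassSize d → ∀ a → weight D a ≡ suc d → ∀ {k} → k < D′ →
                   centralizer D a * ∑ (codes d) (λ c → suc k * mult c k * ξ a k c) ≡ suc (suc k) * a (suc k) * d !
  insertion-term {d} ih a w {k} k<D′ with a (suc k) ≟ 0
  ... | yes aₖ≡0 = begin
    centralizer D a * ∑ (codes d) (λ c → suc k * mult c k * ξ a k c)
      ≡⟨ cong (centralizer D a *_) (∑-zero (codes d)
           (λ c → trans (cong (suc k * mult c k *_) (absent c)) (*-zeroʳ (suc k * mult c k)))) ⟩
    centralizer D a * 0              ≡⟨ *-zeroʳ (centralizer D a) ⟩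
    0 * d !                          ≡⟨ cong (_* d !) (*-zeroʳ (suc (suc k))) ⟨
    suc (suc k) * 0 * d !            ≡⟨ cong (λ n → suc (suc k) * n * d !) aₖ≡0 ⟨
    suc (suc k) * a (suc k) * d !    ∎
    where
    open ≡-Reasoning
    absent : ∀ c → ξ a k c ≡ 0
    absent c = 𝟙-no (eqBelow? D (inc (suc k) (mult c)) (inc k a)) λ eq →
      contradiction (trans (sym (inc-at (suc k) (mult c))) 
        (trans (eq (s≤s k<D′)) (trans (inc-off a (<⇒≢ ≤-refl)) aₖ≡0))) λ ()
  ... | no aₖ≢0 with b , a≗ ← dec (suc k) a aₖ≢0 = begin
    centralizer D a * ∑ (codes d) (λ c → suc k * mult c k * ξ a k c)
      ≡⟨ cong₂ _*_ (trans (centralizer-cong D a≗) (centralizer-inc D (s≤s k<D′) b))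
           (trans (∑-cong (codes d) summand) (sym (*-distribˡ-∑ (suc k * suc (b k)) (codes d) _))) ⟩
    centralizer D b * (suc (suc k) * suc (b (suc k))) * (suc k * suc (b k) * ∑ (codes d) (χ (inc k b)))
      ≡⟨ rearrange (centralizer D b) (suc (suc k)) (suc (b (suc k))) (suc k * suc (b k)) _ ⟩
    suc (suc k) * suc (b (suc k)) * (centralizer D b * (suc k * suc (b k)) * ∑ (codes d) (χ (inc k b)))
      ≡⟨ cong₂ (λ u v → suc (suc k) * u * (v * ∑ (codes d) (χ (inc k b))))
           (sym (trans (a≗ (suc k)) (inc-at (suc k) b))) (sym (centralizer-inc D k<D b)) ⟩
    suc (suc k) * a (suc k) * (centralizer D (inc k b) * ∑ (codes d) (χ (inc k b)))
      ≡⟨ cong (suc (suc k) * a (suc k) *_) (ih (inc k b) weight-b) ⟩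
    suc (suc k) * a (suc k) * d ! ∎
    where
    open ≡-Reasoning
    k<D : k < D
    k<D = m<n⇒m<1+n k<D′
    rearrange : ∀ z s t u x → z * (s * t) * (u * x) ≡ s * t * (z * u * x)
    rearrange = solve-∀
    weight-b : weight D (inc k b) ≡ d
    weight-b = suc-injective (begin
      suc (weight D (inc k b))      ≡⟨ cong suc (weight-inc D k<D b) ⟩
      suc (weight D b + suc k)      ≡⟨ +-suc (weight D b) (suc k) ⟨
      weight D b + suc (suc k)      ≡⟨ weight-inc D (s≤s k<D′) b ⟨
      weight D (inc (suc k) b)      ≡⟨ weight-cong D a≗ ⟨
      weight D a                    ≡⟨ w ⟩
      suc d                         ∎)
    exchange : ∀ x y z → x + (y + z) ≡ y + (x + z)
    exchange = solve-∀
    ξ≡χ : ∀ c → ξ a k c ≡ χ (inc k b) c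
    ξ≡χ c = 𝟙-cong (eqBelow? D _ _) (eqBelow? D _ _)
      (λ eq {j} j<D → +-cancelˡ-≡ (δ (suc k) j) _ _
        (trans (eq j<D) (trans (cong (δ k j +_) (a≗ j)) (exchange (δ k j) (δ (suc k) j) (b j)))))
      (λ eq {j} j<D → trans (cong (δ (suc k) j +_) (eq j<D))
        (trans (exchange (δ (suc k) j) (δ k j) (b j)) (cong (δ k j +_) (sym (a≗ j)))))
    multiplicity-k : ∀ c → mult c k * χ (inc k b) c ≡ suc (b k) * χ (inc k b) c
    multiplicity-k c with eqBelow? D (mult c) (inc k b)
    ... | yes eq = cong (_* 1) (trans (eq k<D) (inc-at k b))
    ... | no _   = trans (*-zeroʳ (mult c k)) (sym (*-zeroʳ (suc (b k))))
    summand : ∀ c → suc k * mult c k * ξ a k c ≡ suc k * suc (b k) * χ (inc k b) c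
    summand c = begin
      suc k * mult c k * ξ a k c              ≡⟨ cong (suc k * mult c k *_) (ξ≡χ c) ⟩
      suc k * mult c k * χ (inc k b) c        ≡⟨ *-assoc (suc k) (mult c k) _ ⟩
      suc k * (mult c k * χ (inc k b) c)      ≡⟨ cong (suc k *_) (multiplicity-k c) ⟩
      suc k * (suc (b k) * χ (inc k b) c)     ≡⟨ *-assoc (suc k) (suc (b k)) _ ⟨
      suc k * suc (b k) * χ (inc k b) c       ∎

  -- Summing over the size of the cycle of 0, the terms size * multiplicity * d! add up to weight *
  -- d!, which is (d + 1) * d!.
  classSize : ∀ d → d ≤ D → ClassSize d
  classSize zero _ a w = begin
    centralizer D a * (χ a [] + 0)
      ≡⟨ cong₂ (λ z x → z * (x + 0)) centralizer≡1 (𝟙-yes (eqBelow? D (mult []) a) (λ k<D → sym (weight≡0 D w k<D))) ⟩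
    1 ∎
    where
    open ≡-Reasoning
    centralizer≡1 : centralizer D a ≡ 1
    centralizer≡1 = trans
      (cong product (map-upTo-cong D (λ k<D → cong (λ n → suc _ ^ n * n !) (weight≡0 D w k<D))))
      (centralizer-zero D)
  classSize (suc d) (s≤s d≤D′) a w = begin
    centralizer D a * ∑ (codes (suc d)) (χ a)
      ≡⟨ cong (centralizer D a *_) (∑-χ-suc d≤D′ a) ⟩
    centralizer D a * (F + ∑ (upTo D′) G)
      ≡⟨ *-distribˡ-+ (centralizer D a) F _ ⟩
    centralizer D a * F + centralizer D a * ∑ (upTo D′) G
      ≡⟨ cong₂ _+_ (fixed-point-term ih a w) (trans (*-distribˡ-∑ (centralizer D a) (upTo D′) G)
           (cong sum (map-upTo-cong D′ (λ k<D′ → insertion-term ih a w k<D′)))) ⟩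
    a 0 * d ! + ∑ (upTo D′) (λ k → suc (suc k) * a (suc k) * d !)
      ≡⟨ cong₂ _+_ (cong (_* d !) (sym (+-identityʳ (a 0))))
           (sym (*-distribʳ-∑ (d !) (upTo D′) (λ k → suc (suc k) * a (suc k)))) ⟩
    1 * a 0 * d ! + ∑ (upTo D′) (λ k → suc (suc k) * a (suc k)) * d !
      ≡⟨ *-distribʳ-+ (d !) (1 * a 0) _ ⟨
    (1 * a 0 + ∑ (upTo D′) (λ k → suc (suc k) * a (suc k))) * d !
      ≡⟨ cong (_* d !) (trans (sym (∑-upTo-suc D′ (λ k → suc k * a k))) w) ⟩
    suc d * d ! ∎
    where
    open ≡-Reasoning
    ih = classSize d (m≤n⇒m≤1+n d≤D′)
    F = ∑ (codes d) (λ c → χ a (zero ∷ c))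
    G : ℕ → ℕ
    G k = ∑ (codes d) (λ c → suc k * mult c k * ξ a k c)

-- Counting tuples

𝟙-true : ∀ {b} {Q : Set} (Q? : Dec Q) → (b ≡ true → Q) → (Q → b ≡ true) → 𝟙 b ≡ 𝟙 (does Q?)
𝟙-true {true}  Q? f g = sym (𝟙-yes Q? (f refl))
𝟙-true {false} Q? f g = sym (𝟙-no Q? (λ q → contradiction (g q) λ ()))

⌊⌋-sound : ∀ {Q : Set} (Q? : Dec Q) → ⌊ Q? ⌋ ≡ true → Q
⌊⌋-sound (yes q) _ = q

⌊⌋-complete : ∀ {Q : Set} (Q? : Dec Q) → Q → ⌊ Q? ⌋ ≡ true
⌊⌋-complete (yes _) _ = refl
⌊⌋-complete (no ¬q) q = contradiction q ¬q

and-upTo-sound : ∀ n (f : ℕ → Bool) → and (map f (upTo n)) ≡ true → ∀ {k} → k < n → f k ≡ true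
and-upTo-sound n f eq = go n f (trans (cong and (sym (map-applyUpTo (λ i → i) f n))) eq)
  where
  go : ∀ n (f : ℕ → Bool) → and (applyUpTo f n) ≡ true → ∀ {k} → k < n → f k ≡ true
  go (suc n) f eq k<n with f 0 in eq₀
  go (suc n) f eq {zero}  k<n       | true = eq₀
  go (suc n) f eq {suc k} (s≤s k<n) | true = go n (f ∘ suc) eq k<n

and-upTo-complete : ∀ n (f : ℕ → Bool) → (∀ {k} → k < n → f k ≡ true) → and (map f (upTo n)) ≡ true
and-upTo-complete n f eq = trans (cong and (map-applyUpTo (λ i → i) f n)) (go n f eq)
  where
  go : ∀ n (f : ℕ → Bool) → (∀ {k} → k < n → f k ≡ true) → and (applyUpTo f n) ≡ true
  go zero    f eq = refl
  go (suc n) f eq rewrite eq {0} (s≤s z≤n) = go n (f ∘ suc) (λ k<n → eq (s≤s k<n))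

and-false : ∀ {A : Set} (f : A → Bool) xs → and (map f xs) ≡ false → ∃[ x ] f x ≡ false
and-false f (x ∷ xs) eq with f x in eqₓ
... | false = x , eqₓ
... | true  = and-false f xs eq

-- Partitions as multiplicity functions, and the cycle-type test on codes.

type : List ℕ → ℕ → ℕ
type μ k = multiplicity (suc k) μ

type-∷ : ∀ m μ k → type (suc m ∷ μ) k ≡ inc m (type μ) k
type-∷ m μ k = trans (length-filter≡∑ (λ j → j ≟ suc k) (suc m ∷ μ))
  (cong (δ m k +_) (sym (length-filter≡∑ (λ j → j ≟ suc k) μ)))

Parts : ℕ → List ℕ → Set
Parts D = All (λ m → 0 < m × m ≤ D)

weight-type : ∀ {D μ} → Parts D μ → weight D (type μ) ≡ sum μ
weight-type {D} [] = ∑-zero (upTo D) (λ k → *-zeroʳ (suc k))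
weight-type {D} {suc m ∷ μ} ((_ , m<D) ∷ ps) = begin
  weight D (type (suc m ∷ μ))   ≡⟨ weight-cong D (type-∷ m μ) ⟩
  weight D (inc m (type μ))     ≡⟨ weight-inc D m<D (type μ) ⟩
  weight D (type μ) + suc m     ≡⟨ cong (_+ suc m) (weight-type ps) ⟩
  sum μ + suc m                 ≡⟨ +-comm (sum μ) (suc m) ⟩
  sum (suc m ∷ μ)               ∎
  where open ≡-Reasoning

∑-type : ∀ {D μ} → Parts D μ → ∑ (upTo D) (type μ) ≡ length μ
∑-type {D} [] = ∑-zero (upTo D) (λ k → refl)
∑-type {D} {suc m ∷ μ} ((_ , m<D) ∷ ps) = begin
  ∑ (upTo D) (type (suc m ∷ μ))   ≡⟨ ∑-cong (upTo D) (type-∷ m μ) ⟩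
  ∑ (upTo D) (inc m (type μ))     ≡⟨ ∑-upTo-update D m<D (type μ) (inc m (type μ)) 1
                                       (λ j j≢m → inc-off (type μ) (j≢m ∘ sym)) (trans (inc-at m (type μ)) (+-comm 1 _)) ⟩
  ∑ (upTo D) (type μ) + 1         ≡⟨ cong (_+ 1) (∑-type ps) ⟩
  length μ + 1                    ≡⟨ +-comm (length μ) 1 ⟩
  suc (length μ)                  ∎
  where open ≡-Reasoning

∏-type : ∀ {D μ} → Parts D μ → ∏ (upTo D) (λ k → suc k ^ type μ k) ≡ product μ
∏-type {zero}  [] = refl
∏-type {suc D} [] = trans (∏-upTo-suc D (λ k → suc k ^ 0)) (trans (+-identityʳ _) (∏-type {D} []))
∏-type {D} {suc m ∷ μ} ((_ , m<D) ∷ ps) = begin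
  ∏ (upTo D) (λ k → suc k ^ type (suc m ∷ μ) k)   ≡⟨ ∏-cong (upTo D) (λ k → cong (suc k ^_) (type-∷ m μ k)) ⟩
  ∏ (upTo D) (λ k → suc k ^ inc m (type μ) k)
    ≡⟨ ∏-upTo-update D m<D (λ k → suc k ^ type μ k) (λ k → suc k ^ inc m (type μ) k) (suc m)
         (λ j j≢m → cong (suc j ^_) (inc-off (type μ) (j≢m ∘ sym)))
         (trans (cong (suc m ^_) (inc-at m (type μ))) (*-comm (suc m) _)) ⟩
  ∏ (upTo D) (λ k → suc k ^ type μ k) * suc m     ≡⟨ cong (_* suc m) (∏-type ps) ⟩
  product μ * suc m                               ≡⟨ *-comm (product μ) (suc m) ⟩
  product (suc m ∷ μ)                             ∎
  where open ≡-Reasoning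

parts : ∀ {μ} → All (0 <_) μ → Parts (sum μ) μ
parts [] = []
parts {m ∷ μ} (0<m ∷ ps) =
  (0<m , m≤m+n m (sum μ)) ∷ All.map (λ (0<k , k≤) → 0<k , ≤-trans k≤ (m≤n+m (sum μ) m)) (parts ps)

multiplicity-0 : ∀ {μ} → All (0 <_) μ → multiplicity 0 μ ≡ 0
multiplicity-0 [] = refl
multiplicity-0 {suc m ∷ μ} (_ ∷ ps) = multiplicity-0 ps

centralizer-type : ∀ {μ} → All (0 <_) μ → centralizer (sum μ) (type μ) ≡ autSize μ * product μ
centralizer-type {μ} ps = begin
  centralizer (sum μ) (type μ)
    ≡⟨ ∏-distrib-* (upTo (sum μ)) (λ k → suc k ^ type μ k) (λ k → type μ k !) ⟩
  ∏ (upTo (sum μ)) (λ k → suc k ^ type μ k) * ∏ (upTo (sum μ)) (λ k → type μ k !)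
    ≡⟨ cong₂ _*_ (∏-type (parts ps)) aut ⟩
  product μ * autSize μ
    ≡⟨ *-comm (product μ) (autSize μ) ⟩
  autSize μ * product μ ∎
  where
  open ≡-Reasoning
  aut : ∏ (upTo (sum μ)) (λ k → type μ k !) ≡ autSize μ
  -- `autSize` has an extra factor at k = 0, which is 0! = 1 because all parts are positive.
  aut = sym (trans (∏-upTo-suc (sum μ) (λ k → multiplicity k μ !))
    (trans (cong (λ n → n ! * ∏ (upTo (sum μ)) (λ k → type μ k !)) (multiplicity-0 ps)) (*-identityˡ _)))

pointsInCycles-suc : ∀ {d} (c : Code d) k → pointsInCycles (eval c) (suc k) ≡ suc k * mult c k
pointsInCycles-suc {d} c k = begin
  pointsInCycles (eval c) (suc k)
    ≡⟨ length-filter≡∑ (λ x → orbitLength (eval c) x ≟ suc k) (allFin d) ⟩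
  ∑ (allFin d) (λ x → 𝟙 (does (orbitLength (eval c) x ≟ suc k)))
    ≡⟨ ∑-cong (allFin d) (λ x → cong (λ n → 𝟙 (does (n ≟ suc k))) (orbitLength-eval c x)) ⟩
  ∑ (allFin d) (λ x → δ (top c (label c x)) k)
    ≡⟨ ∑-label c (λ l → δ (top c l) k) ⟩
  ∑ L (λ l → suc (top c l) * δ (top c l) k)
    ≡⟨ ∑-cong L (λ l → collapse (top c l)) ⟩
  ∑ L (λ l → suc k * δ (top c l) k)
    ≡⟨ *-distribˡ-∑ (suc k) L _ ⟨
  suc k * mult c k ∎
  where
  open ≡-Reasoning
  L = allFin (numCycles c)
  collapse : ∀ t → suc t * δ t k ≡ suc k * δ t k
  collapse t with t ≟ k
  ... | yes refl = refl
  ... | no t≢k   = trans (cong (suc t *_) (𝟙-no (t ≟ k) t≢k))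
    (trans (trans (*-zeroʳ (suc t)) (sym (*-zeroʳ (suc k)))) (cong (suc k *_) (sym (𝟙-no (t ≟ k) t≢k))))

pointsInCycles-0 : ∀ {d} (c : Code d) → pointsInCycles (eval c) 0 ≡ 0
pointsInCycles-0 {d} c = trans (length-filter≡∑ (λ x → orbitLength (eval c) x ≟ 0) (allFin d))
  (∑-zero (allFin d) (λ x → cong (λ n → 𝟙 (does (n ≟ 0))) (orbitLength-eval c x)))

hasCycleType-sound : ∀ {d} (c : Code d) μ → hasCycleType (eval c) μ ≡ true → ∀ {k} → k < d → mult c k ≡ type μ k
hasCycleType-sound {d} c μ eq {k} k<d = *-cancelˡ-≡ _ _ (suc k) (trans (sym (pointsInCycles-suc c k))
  (⌊⌋-sound (pointsInCycles (eval c) (suc k) ≟ suc k * multiplicity (suc k) μ) (and-upTo-sound (suc d) _ eq (s≤s k<d))))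

hasCycleType-complete : ∀ {d} (c : Code d) μ → (∀ {k} → k < d → mult c k ≡ type μ k) → hasCycleType (eval c) μ ≡ true
hasCycleType-complete {d} c μ eq = and-upTo-complete (suc d) _ λ {k} k<d →
  ⌊⌋-complete (pointsInCycles (eval c) k ≟ k * multiplicity k μ) (points k k<d)
  where
  points : ∀ k → k < suc d → pointsInCycles (eval c) k ≡ k * multiplicity k μ
  points zero    _         = pointsInCycles-0 c
  points (suc k) (s≤s k<d) = trans (pointsInCycles-suc c k) (cong (suc k *_) (eq k<d))

hasCycleType-cong : ∀ {d} {σ τ : Fin d → Fin d} → (∀ x → σ x ≡ τ x) → ∀ μ → hasCycleType σ μ ≡ hasCycleType τ μ
hasCycleType-cong {d} {σ} {τ} σ≗τ μ =
  cong and (map-cong (λ k → cong (λ n → ⌊ n ≟ k * multiplicity k μ ⌋) (points k)) (upTo (suc d)))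
  where
  points : ∀ k → pointsInCycles σ k ≡ pointsInCycles τ k
  points k = begin
    pointsInCycles σ k
      ≡⟨ length-filter≡∑ (λ x → orbitLength σ x ≟ k) (allFin d) ⟩
    ∑ (allFin d) (λ x → 𝟙 (does (orbitLength σ x ≟ k)))
      ≡⟨ ∑-cong (allFin d) (λ x → cong (λ n → 𝟙 (does (n ≟ k))) (orbitLength-cong σ≗τ x)) ⟩
    ∑ (allFin d) (λ x → 𝟙 (does (orbitLength τ x ≟ k)))
      ≡⟨ length-filter≡∑ (λ x → orbitLength τ x ≟ k) (allFin d) ⟨
    pointsInCycles τ k ∎
    where open ≡-Reasoning

inClass : ∀ {d} → List ℕ → Code d → ℕ
inClass μ c = 𝟙 (hasCycleType (eval c) μ)

∑-inClass : ∀ {μ} → All (0 <_) μ → 0 < sum μ → ∑ (codes (sum μ)) (inClass μ) * (autSize μ * product μ) ≡ sum μ !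
∑-inClass {μ} ps 0<d = begin
  ∑ (codes d) (inClass μ) * (autSize μ * product μ)
    ≡⟨ *-comm _ (autSize μ * product μ) ⟩
  autSize μ * product μ * ∑ (codes d) (inClass μ)
    ≡⟨ cong₂ _*_ (sym (centralizer-type ps)) (∑-cong (codes d) inClass≡) ⟩
  centralizer d (type μ) * ∑ (codes d) (λ c → 𝟙 (does (eqBelow? d (mult c) (type μ))))
    ≡⟨ class-size 0<d ⟩
  d ! ∎
  where
  open ≡-Reasoning
  d = sum μ
  inClass≡ : ∀ (c : Code d) → inClass μ c ≡ 𝟙 (does (eqBelow? d (mult c) (type μ)))
  inClass≡ c = 𝟙-true (eqBelow? d (mult c) (type μ)) (hasCycleType-sound c μ) (hasCycleType-complete c μ)
  class-size : 0 < d → centralizer d (type μ) * ∑ (codes d) (λ c → 𝟙 (does (eqBelow? d (mult c) (type μ)))) ≡ d !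
  class-size 0<d with d in eq
  ... | suc D′ = Count.classSize D′ (suc D′) ≤-refl (type μ)
    (trans (cong (λ D → weight D (type μ)) (sym eq)) (trans (weight-type (parts ps)) eq))

-- Signs of the class and of the number of branch points.

not^-not : ∀ m b → not^ m (not b) ≡ not (not^ m b)
not^-not zero    b = refl
not^-not (suc m) b = not^-not m (not b)

not^-+ : ∀ m n b → not^ (m + n) b ≡ not^ n (not^ m b)
not^-+ zero    n b = refl
not^-+ (suc m) n b = not^-+ m n (not b)

not^-involutive : ∀ m b → not^ m (not^ m b) ≡ b
not^-involutive zero    b = refl
not^-involutive (suc m) b = trans (cong (not^ m) (sym (not^-not m (not b))))
  (trans (cong (not^ m ∘ not^ m) (not-involutive b)) (not^-involutive m b))

-- A zero digit adds a cycle and no transposition, a nonzero digit a transposition and no cycle;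
-- together they number d.
not^-numCycles : ∀ {d} (c : Code d) → not^ (numCycles c) (isOdd c) ≡ not^ d false
not^-numCycles []          = refl
not^-numCycles {suc d} (zero ∷ c)  = trans (not^-not (numCycles c) (isOdd c))
  (trans (cong not (not^-numCycles c)) (sym (not^-not d false)))
not^-numCycles {suc d} (suc j ∷ c) = trans (not^-not (numCycles c) (isOdd c))
  (trans (cong not (not^-numCycles c)) (sym (not^-not d false)))

numCycles≡∑-mult : ∀ {d} (c : Code d) → numCycles c ≡ ∑ (upTo d) (mult c)
numCycles≡∑-mult {d} c = begin
  numCycles c                              ≡⟨ length-tabulate {n = numCycles c} (λ i → i) ⟨
  length (allFin (numCycles c))            ≡⟨ *-identityʳ _ ⟨
  length (allFin (numCycles c)) * 1        ≡⟨ ∑-const (allFin (numCycles c)) 1 ⟨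
  ∑ (allFin (numCycles c)) (λ _ → 1)       ≡⟨ ∑-top c ≤-refl (λ _ → 1) ⟩
  ∑ (upTo d) (λ k → mult c k * 1)          ≡⟨ ∑-cong (upTo d) (λ k → *-identityʳ (mult c k)) ⟩
  ∑ (upTo d) (mult c)                      ∎
  where open ≡-Reasoning

classParity : List ℕ → Bool
classParity μ = not^ (length μ) (not^ (sum μ) false)

inClass-vanishesOff : ∀ {μ} → All (0 <_) μ → VanishesOff (classParity μ) (inClass {sum μ} μ)
inClass-vanishesOff {μ} ps c odd≢ with hasCycleType (eval c) μ in eq
... | false = refl
... | true  = contradiction (begin
  isOdd c                                          ≡⟨ not^-involutive (length μ) (isOdd c) ⟨
  not^ (length μ) (not^ (length μ) (isOdd c))      ≡⟨ cong (λ n → not^ (length μ) (not^ n (isOdd c))) cycles ⟨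
  not^ (length μ) (not^ (numCycles c) (isOdd c))   ≡⟨ cong (not^ (length μ)) (not^-numCycles c) ⟩
  classParity μ                                    ∎) odd≢
  where
  open ≡-Reasoning
  cycles : numCycles c ≡ length μ
  cycles = trans (numCycles≡∑-mult c)
    (trans (cong sum (map-upTo-cong (sum μ) (hasCycleType-sound c μ eq))) (∑-type (parts ps)))

-- With n parts and m branch points, d + n + m = 2(d + g + n - 1); the bound 2 ≤ d makes the
-- truncated subtractions exact.
numBranch-parity : ∀ g {μ} → 2 ≤ sum μ → not^ (numBranch g μ) (classParity μ) ≡ false
numBranch-parity g {μ} 2≤d = begin
  not^ m (not^ n (not^ d false))     ≡⟨ cong (not^ m) (not^-+ d n false) ⟨
  not^ m (not^ (d + n) false)        ≡⟨ not^-+ (d + n) m false ⟨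
  not^ (d + n + m) false             ≡⟨ cong (λ k → not^ k false) (even 2≤d) ⟩
  not^ ((d + g + n ∸ 1) * 2) false   ≡⟨ not^-*2 (d + g + n ∸ 1) false ⟩
  false                              ∎
  where
  open ≡-Reasoning
  d = sum μ
  n = length μ
  m = numBranch g μ
  even : ∀ {d} → 2 ≤ d → d + n + (d + 2 * g + n ∸ 2) ≡ (d + g + n ∸ 1) * 2
  even {suc (suc e)} (s≤s (s≤s z≤n)) = lemma e g n
    where
    lemma : ∀ e g n → suc (suc e) + n + (e + 2 * g + n) ≡ suc (e + g + n) * 2
    lemma = solve-∀

-- Pairs starting at 0 number d and the others are the pairs on the remaining d points, so the count
-- obeys Pascal's rule.
length-transpositions : ∀ d → length (transpositions d) ≡ d C 2
length-transpositions d = begin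
  length (transpositions d)
    ≡⟨ length-filter≡∑ (λ p → toℕ (proj₁ p) <? toℕ (proj₂ p)) (concatMap (λ i → map (i ,_) (allFin d)) (allFin d)) ⟩
  ∑ (concatMap (λ i → map (i ,_) (allFin d)) (allFin d)) (λ p → 𝟙 (does (toℕ (proj₁ p) <? toℕ (proj₂ p))))
    ≡⟨ ∑-concatMap (λ i → map (i ,_) (allFin d)) (allFin d) _ ⟩
  ∑ (allFin d) (λ i → ∑ (map (i ,_) (allFin d)) (λ p → 𝟙 (does (toℕ (proj₁ p) <? toℕ (proj₂ p)))))
    ≡⟨ ∑-cong (allFin d) (λ i → ∑-map (i ,_) (allFin d) _) ⟩
  ∑ (allFin d) (λ i → ∑ (allFin d) (λ j → 𝟙 (does (toℕ i <? toℕ j))))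
    ≡⟨ go d ⟩
  d C 2 ∎
  where
  open ≡-Reasoning
  lt : ℕ → ℕ → ℕ
  lt a b = 𝟙 (does (a <? b))
  go : ∀ d → ∑ (allFin d) (λ i → ∑ (allFin d) (λ j → lt (toℕ i) (toℕ j))) ≡ d C 2
  go zero    = refl
  go (suc d) = begin
    ∑ (allFin (suc d)) (λ i → ∑ (allFin (suc d)) (λ j → lt (toℕ i) (toℕ j)))
      ≡⟨ ∑-allFin-suc d _ ⟩
    ∑ (allFin (suc d)) (λ j → lt 0 (toℕ j)) +
    ∑ (allFin d) (λ i → ∑ (allFin (suc d)) (λ j → lt (suc (toℕ i)) (toℕ j)))
      ≡⟨ cong₂ _+_ first-row (trans (∑-cong (allFin d) (λ i → ∑-allFin-suc d (λ j → lt (suc (toℕ i)) (toℕ j))))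
           (trans (∑-cong (allFin d) (λ i → ∑-cong (allFin d) (λ j → lt-suc (toℕ i) (toℕ j)))) (go d))) ⟩
    d C 1 + d C 2
      ≡⟨ nCk+nC[k+1]≡[n+1]C[k+1] d 1 ⟩
    suc d C 2 ∎
    where
    lt-suc : ∀ a b → lt (suc a) (suc b) ≡ lt a b
    lt-suc a b = 𝟙-cong (suc a <? suc b) (a <? b) s≤s⁻¹ s≤s
    first-row : ∑ (allFin (suc d)) (λ j → lt 0 (toℕ j)) ≡ d C 1
    first-row = begin
      ∑ (allFin (suc d)) (λ j → lt 0 (toℕ j))     ≡⟨ ∑-allFin-suc d (λ j → lt 0 (toℕ j)) ⟩
      ∑ (allFin d) (λ j → 1)                      ≡⟨ ∑-const (allFin d) 1 ⟩
      length (allFin d) * 1                       ≡⟨ *-identityʳ _ ⟩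
      length (allFin d)                           ≡⟨ length-tabulate {n = d} (λ i → i) ⟩
      d                                           ≡⟨ nC1≡n d ⟨
      d C 1                                       ∎

-- Intransitive tuples are negligible.

closeStep-keeps : ∀ {d} (ts : List (Transposition d)) S y → S y ≡ true → closeStep ts S y ≡ true
closeStep-keeps []       S y Sy rewrite Sy = refl
closeStep-keeps (t ∷ ts) S y Sy rewrite Sy = refl

-- The recursive call is accepted because the local function of closeStep
-- ignores the list it is parametrised by.
closeStep-neighbour : ∀ {d} (ts : List (Transposition d)) (S : Fin d → Bool) y {t} → t ∈ ts →
                      S (swap t y) ≡ true → closeStep ts S y ≡ true
closeStep-neighbour (t ∷ ts) S y (here refl) Sy rewrite Sy = ∨-zeroʳ (S y)
closeStep-neighbour (t ∷ ts) S y (there p) Sy with closeStep-neighbour ts S y p Sy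
... | ih with S y
... | true  = refl
... | false with S (swap t y)
... | true  = refl
... | false = ih

orbit-zero : ∀ {d} (ts : List (Transposition (suc d))) k → iter k (closeStep ts) (λ y → does (y ≟ᶠ zero)) zero ≡ true
orbit-zero ts zero    = refl
orbit-zero ts (suc k) = closeStep-keeps ts (iter k (closeStep ts) _) zero (orbit-zero ts k)

orbit-neighbour : ∀ {d} (ts : List (Transposition (suc d))) x → (zero , x) ∈ ts → orbit ts zero x ≡ true
orbit-neighbour {d} ts x p = closeStep-neighbour ts (iter d (closeStep ts) _) x p
  (trans (cong (iter d (closeStep ts) _) (swap-right zero x)) (orbit-zero ts d))

_≟ᵗ_ : ∀ {d} (s t : Transposition d) → Dec (s ≡ t)
_≟ᵗ_ = ≡-dec _≟ᶠ_ _≟ᶠ_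

-- Its product along a tuple indicates that `t` is avoided. The product form makes the sum over all
-- m-tuples factor into an m-th power.
differs : ∀ {d} → Transposition d → Transposition d → ℕ
differs t s = 𝟙 (not (does (s ≟ᵗ t)))

∏-differs : ∀ {d} (t : Transposition d) ts → t ∉ ts → ∏ ts (differs t) ≡ 1
∏-differs t []       t∉ = refl
∏-differs t (s ∷ ts) t∉ with s ≟ᵗ t
... | yes refl = contradiction (here refl) t∉
... | no _     = trans (+-identityʳ _) (∏-differs t ts (t∉ ∘ there))

∑-tuples-∏ : ∀ {A : Set} m (xs : List A) f → ∑ (tuples m xs) (λ ts → ∏ ts f) ≡ ∑ xs f ^ m
∑-tuples-∏ zero    xs f = refl
∑-tuples-∏ (suc m) xs f = begin
  ∑ (tuples (suc m) xs) (λ ts → ∏ ts f)                        ≡⟨ ∑-concatMap (λ x → map (x ∷_) (tuples m xs)) xs _ ⟩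
  ∑ xs (λ x → ∑ (map (x ∷_) (tuples m xs)) (λ ts → ∏ ts f))    ≡⟨ ∑-cong xs (λ x → trans (∑-map (x ∷_) (tuples m xs) _)
                                                                    (sym (*-distribˡ-∑ (f x) (tuples m xs) _))) ⟩
  ∑ xs (λ x → f x * ∑ (tuples m xs) (λ ts → ∏ ts f))           ≡⟨ *-distribʳ-∑ _ xs f ⟨
  ∑ xs f * ∑ (tuples m xs) (λ ts → ∏ ts f)                     ≡⟨ cong (∑ xs f *_) (∑-tuples-∏ m xs f) ⟩
  ∑ xs f ^ suc m                                               ∎
  where open ≡-Reasoning

∑-differs : ∀ {d} {t : Transposition d} → t ∈ transpositions d →
            suc (∑ (transpositions d) (differs t)) ≤ length (transpositions d)
∑-differs {d} {t} t∈ = begin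
  1 + ∑ T (differs t)                ≤⟨ ∑-exchange t∈ (λ _ → 1) (differs t) (λ s _ → 𝟙≤1 (not (does (s ≟ᵗ t)))) ⟩
  ∑ T (λ _ → 1) + differs t t        ≡⟨ cong₂ _+_ (trans (∑-const T 1) (*-identityʳ (length T))) itself ⟩
  length T + 0                       ≡⟨ +-identityʳ (length T) ⟩
  length T                           ∎
  where
  open ≤-Reasoning
  T = transpositions d
  itself : differs t t ≡ 0
  itself with t ≟ᵗ t
  ... | yes _  = refl
  ... | no t≢t = contradiction refl t≢t

∑-term : ∀ {A : Set} {xs : List A} {x} → x ∈ xs → (f : A → ℕ) → f x ≤ ∑ xs f
∑-term (here refl) f = m≤m+n _ _
∑-term (there x∈)  f = ≤-trans (∑-term x∈ f) (m≤n+m _ _)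

-- A tuple that contains all transpositions (0 y) is transitive, so an
-- intransitive one avoids one of them.
intransitive-≤ : ∀ {d} (ts : List (Transposition (suc d))) →
                 𝟙 (not (isTransitive ts)) ≤ ∑ (allFin d) (λ y → ∏ ts (differs (zero , suc y)))
intransitive-≤ {d} ts with isTransitive ts in eq
... | true  = z≤n
... | false with and-false (orbit ts zero) (allFin (suc d)) eq
... | zero  , unreached = contradiction (trans (sym unreached) (orbit-zero ts (suc d))) λ ()
... | suc y , unreached = ≤-trans (≤-reflexive (sym (∏-differs (zero , suc y) ts avoided)))
  (∑-term (∈-allFin y) (λ y → ∏ ts (differs (zero , suc y))))
  where
  avoided : (zero , suc y) ∉ ts
  avoided p = contradiction (trans (sym unreached) (orbit-neighbour ts (suc y) p)) λ ()

intransitive-count : ∀ {d n} m → length (transpositions (suc d)) ≡ suc n →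
                     ∑ (tuples m (transpositions (suc d))) (λ ts → 𝟙 (not (isTransitive ts))) ≤ d * n ^ m
intransitive-count {d} {n} m N≡ = begin
  ∑ Ts (λ ts → 𝟙 (not (isTransitive ts)))
    ≤⟨ ∑-mono Ts intransitive-≤ ⟩
  ∑ Ts (λ ts → ∑ (allFin d) (λ y → ∏ ts (differs (zero , suc y))))
    ≡⟨ ∑-comm Ts (allFin d) _ ⟩
  ∑ (allFin d) (λ y → ∑ Ts (λ ts → ∏ ts (differs (zero , suc y))))
    ≡⟨ ∑-cong (allFin d) (λ y → ∑-tuples-∏ m (transpositions (suc d)) _) ⟩
  ∑ (allFin d) (λ y → ∑ (transpositions (suc d)) (differs (zero , suc y)) ^ m)
    ≤⟨ ∑-mono (allFin d) (λ y → ^-monoˡ-≤ m (bound y)) ⟩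
  ∑ (allFin d) (λ y → n ^ m)
    ≡⟨ ∑-const (allFin d) (n ^ m) ⟩
  length (allFin d) * n ^ m
    ≡⟨ cong (_* n ^ m) (length-tabulate {n = d} (λ i → i)) ⟩
  d * n ^ m ∎
  where
  open ≤-Reasoning
  Ts = tuples m (transpositions (suc d))
  bound : ∀ y → ∑ (transpositions (suc d)) (differs (zero , suc y)) ≤ n
  bound y = s≤s⁻¹ (subst (suc (∑ (transpositions (suc d)) (differs (zero , suc y))) ≤_) N≡
    (∑-differs (∈-transpositions zero (suc y) (s≤s z≤n))))

hurwitzCount≡∑ : ∀ g μ → hurwitzCount g μ ≡
  ∑ (tuples (numBranch g μ) (transpositions (sum μ))) (λ ts → 𝟙 (isTransitive ts ∧ hasCycleType (prodT ts) μ))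
hurwitzCount≡∑ g μ = trans (length-filter≡∑ (λ ts → isTransitive ts ∧ hasCycleType (prodT ts) μ ≟ᵇ true) Ts)
  (∑-cong Ts (λ ts → sym (𝟙-true (isTransitive ts ∧ hasCycleType (prodT ts) μ ≟ᵇ true) (λ e → e) (λ e → e))))
  where Ts = tuples (numBranch g μ) (transpositions (sum μ))

classCount : ℕ → List ℕ → ℕ
classCount g μ = P^ (numBranch g μ) (inClass μ) (idCode {sum μ})

classCount≡∑ : ∀ g μ → classCount g μ ≡
  ∑ (tuples (numBranch g μ) (transpositions (sum μ))) (λ ts → 𝟙 (hasCycleType (prodT ts) μ))
classCount≡∑ g μ = trans (sym (∑-tuples (numBranch g μ) (inClass μ)))
  (∑-cong (tuples (numBranch g μ) (transpositions (sum μ))) (λ ts → cong 𝟙 (hasCycleType-cong (eval-codeOf ts) μ)))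

hurwitzCount-≤ : ∀ g μ → hurwitzCount g μ ≤ classCount g μ
hurwitzCount-≤ g μ = begin
  hurwitzCount g μ                                               ≡⟨ hurwitzCount≡∑ g μ ⟩
  ∑ Ts (λ ts → 𝟙 (isTransitive ts ∧ hasCycleType (prodT ts) μ))  ≤⟨ ∑-mono Ts (λ ts → drop (isTransitive ts) _) ⟩
  ∑ Ts (λ ts → 𝟙 (hasCycleType (prodT ts) μ))                    ≡⟨ classCount≡∑ g μ ⟨
  classCount g μ                                                 ∎
  where
  open ≤-Reasoning
  Ts = tuples (numBranch g μ) (transpositions (sum μ))
  drop : ∀ a b → 𝟙 (a ∧ b) ≤ 𝟙 b
  drop true  b = ≤-refl
  drop false b = z≤n

hurwitzCount-≥ : ∀ g μ {e n} → sum μ ≡ suc e → length (transpositions (sum μ)) ≡ suc n →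
                 classCount g μ ≤ hurwitzCount g μ + e * n ^ numBranch g μ
hurwitzCount-≥ g μ {e} {n} d≡ N≡ = begin
  classCount g μ                                                 ≡⟨ classCount≡∑ g μ ⟩
  ∑ Ts (λ ts → 𝟙 (hasCycleType (prodT ts) μ))                    ≤⟨ ∑-mono Ts (λ ts → split (isTransitive ts) _) ⟩
  ∑ Ts (λ ts → 𝟙 (isTransitive ts ∧ hasCycleType (prodT ts) μ) + 𝟙 (not (isTransitive ts)))
                                                                 ≡⟨ ∑-distrib-+ Ts _ _ ⟩
  ∑ Ts (λ ts → 𝟙 (isTransitive ts ∧ hasCycleType (prodT ts) μ)) + ∑ Ts (λ ts → 𝟙 (not (isTransitive ts)))
    ≤⟨ +-mono-≤ (≤-reflexive (sym (hurwitzCount≡∑ g μ))) (intransitive d≡ N≡) ⟩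
  hurwitzCount g μ + e * n ^ numBranch g μ                       ∎
  where
  open ≤-Reasoning
  Ts = tuples (numBranch g μ) (transpositions (sum μ))
  split : ∀ a b → 𝟙 b ≤ 𝟙 (a ∧ b) + 𝟙 (not a)
  split true  b = m≤m+n _ _
  split false b = 𝟙≤1 b
  intransitive : ∀ {d} → d ≡ suc e → length (transpositions d) ≡ suc n →
                 ∑ (tuples (numBranch g μ) (transpositions d)) (λ ts → 𝟙 (not (isTransitive ts))) ≤ e * n ^ numBranch g μ
  intransitive refl = intransitive-count (numBranch g μ)

-- Asymptotics

-- Bernoulli's inequality (1 + 1/a)^q ≥ 1 + q/a with denominators cleared.
bernoulli : ∀ a q → a ^ q * (a + q) ≤ a * suc a ^ q
bernoulli a zero    = ≤-reflexive (trans (*-identityˡ (a + 0)) (trans (+-identityʳ a) (sym (*-identityʳ a))))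
bernoulli a (suc q) = begin
  a * a ^ q * (a + suc q)                ≡⟨ expand a (a ^ q) q ⟩
  a * (a ^ q * (a + q)) + a ^ q * a      ≤⟨ +-monoʳ-≤ (a * (a ^ q * (a + q))) (*-monoʳ-≤ (a ^ q) (m≤m+n a q)) ⟩
  a * (a ^ q * (a + q)) + a ^ q * (a + q) ≡⟨ +-comm (a * (a ^ q * (a + q))) _ ⟩
  suc a * (a ^ q * (a + q))              ≤⟨ *-monoʳ-≤ (suc a) (bernoulli a q) ⟩
  suc a * (a * suc a ^ q)                ≡⟨ swap-factors (suc a) a (suc a ^ q) ⟩
  a * suc a ^ suc q                      ∎
  where
  open ≤-Reasoning
  expand : ∀ a p q → a * p * (a + suc q) ≡ a * (p * (a + q)) + p * a
  expand = solve-∀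
  swap-factors : ∀ s a p → s * (a * p) ≡ a * (s * p)
  swap-factors = solve-∀

-- For positive a, Bernoulli gives ((a + 1)/a)^q ≥ (a + q)/a, which is at least K once q ≥ K * a.
-- For a = 0 the left side vanishes from q = 1 on.
geometric-decay : ∀ a K → ∃[ Q ] (∀ q → Q ≤ q → K * a ^ q ≤ suc a ^ q)
geometric-decay zero K = 1 , λ { (suc q) _ → ≤-trans (≤-reflexive (*-zeroʳ K)) z≤n }
geometric-decay a@(suc _) K = K * a , λ q Q≤q → *-cancelˡ-≤ a (begin
  a * (K * a ^ q)      ≡⟨ rearrange a K (a ^ q) ⟩
  a ^ q * (K * a)      ≤⟨ *-monoʳ-≤ (a ^ q) (≤-trans Q≤q (m≤n+m q a)) ⟩
  a ^ q * (a + q)      ≤⟨ bernoulli a q ⟩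
  a * suc a ^ q        ∎)
  where
  open ≤-Reasoning
  rearrange : ∀ a k p → a * (k * p) ≡ p * (k * a)
  rearrange = solve-∀

-- In the application F is d!, S the class size, X = |Aut| times the product of the parts, f the
-- count without transitivity, h the Hurwitz count, M = N^m, and `δ`, r are the equidistribution and
-- intransitivity errors. Dividing by S leaves X f within X `δ` of 2M; each error, scaled by k X, is
-- at most M/2, so together they stay strictly below 2M.
squeeze : ∀ {F S X f h M δ r} k .{{_ : NonZero S}} → S * X ≡ F → 0 < M →
          F * f ≤ 2 * (M * S) + F * δ → 2 * (M * S) ≤ F * f + F * δ → h ≤ f → f ≤ h + r →
          2 * k * X * δ ≤ M → 2 * k * X * r ≤ M →
          k * (X * h) < k * (2 * M) + 2 * M × k * (2 * M) < k * (X * h) + 2 * M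
squeeze {F} {S} {X} {f} {h} {M} {δ} {r} k refl 0<M upper lower h≤f f≤h+r δ-small r-small = above , below
  where
  open ≤-Reasoning
  Xf≤ : X * f ≤ 2 * M + X * δ
  Xf≤ = *-cancelˡ-≤ S (subst₂ _≤_ (*-assoc S X f) (rearrange S X M δ) upper)
    where
    rearrange : ∀ s x m e → 2 * (m * s) + s * x * e ≡ s * (2 * m + x * e)
    rearrange = solve-∀
  ≤Xf : 2 * M ≤ X * f + X * δ
  ≤Xf = *-cancelˡ-≤ S (subst₂ _≤_ (rearrange₁ M S) (rearrange₂ S X f δ) lower)
    where
    rearrange₁ : ∀ m s → 2 * (m * s) ≡ s * (2 * m)
    rearrange₁ = solve-∀
    rearrange₂ : ∀ s x u e → s * x * u + s * x * e ≡ s * (x * u + x * e)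
    rearrange₂ = solve-∀
  M<2M : M < 2 * M
  M<2M = m<m+n M (≤-trans 0<M (≤-reflexive (sym (+-identityʳ M))))
  error : k * X * δ + k * X * r < 2 * M
  error = ≤-<-trans (*-cancelˡ-≤ 2 (begin
    2 * (k * X * δ + k * X * r)            ≡⟨ rearrange k X δ r ⟩
    2 * k * X * δ + 2 * k * X * r          ≤⟨ +-mono-≤ δ-small r-small ⟩
    M + M                                  ≡⟨ cong (M +_) (+-identityʳ M) ⟨
    2 * M                                  ∎)) M<2M
    where
    rearrange : ∀ k x d r → 2 * (k * x * d + k * x * r) ≡ 2 * k * x * d + 2 * k * x * r
    rearrange = solve-∀
  above : k * (X * h) < k * (2 * M) + 2 * M
  above = begin-strict
    k * (X * h)                      ≤⟨ *-monoʳ-≤ k (≤-trans (*-monoʳ-≤ X h≤f) Xf≤) ⟩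
    k * (2 * M + X * δ)              ≡⟨ rearrange k (2 * M) X δ ⟩
    k * (2 * M) + k * X * δ          <⟨ +-monoʳ-< (k * (2 * M)) (≤-<-trans (m≤m+n _ _) error) ⟩
    k * (2 * M) + 2 * M              ∎
    where
    rearrange : ∀ k m x d → k * (m + x * d) ≡ k * m + k * x * d
    rearrange = solve-∀
  below : k * (2 * M) < k * (X * h) + 2 * M
  below = begin-strict
    k * (2 * M)                              ≤⟨ *-monoʳ-≤ k ≤Xf ⟩
    k * (X * f + X * δ)                      ≤⟨ *-monoʳ-≤ k (+-monoˡ-≤ (X * δ) (*-monoʳ-≤ X f≤h+r)) ⟩
    k * (X * (h + r) + X * δ)                ≡⟨ rearrange k X h r δ ⟩
    k * (X * h) + (k * X * δ + k * X * r)    <⟨ +-monoʳ-< (k * (X * h)) error ⟩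
    k * (X * h) + 2 * M                      ∎
    where
    rearrange : ∀ k x h r d → k * (x * (h + r) + x * d) ≡ k * (x * h) + (k * x * d + k * x * r)
    rearrange = solve-∀

transposition-exists : ∀ {d} → 2 ≤ d → ∃[ t ] (t ∈ transpositions d)
transposition-exists (s≤s (s≤s z≤n)) = (zero , suc zero) , ∈-transpositions zero (suc zero) (s≤s z≤n)

-- The number of steps is kept as a variable m, so that the division equation can be matched on when
-- m is the number of branch points.
equidistribution-at : ∀ {d} {t₀ : Transposition d} → t₀ ∈ transpositions d →
  let N = length (transpositions d) in
  ∀ {a} → N ^ (d * 2) ≡ suc a → ∀ {φ : Code d → ℕ} {b} → (∀ c → φ c ≤ 1) → VanishesOff b φ →
  ∀ {m} r q → m ≡ r + q * (d * 2) → not^ m b ≡ false →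
  d ! * P^ m φ idCode ≤ 2 * (N ^ m * ∑ (codes d) φ) + d ! * (a ^ q * N ^ r) ×
  2 * (N ^ m * ∑ (codes d) φ) ≤ d ! * P^ m φ idCode + d ! * (a ^ q * N ^ r)
equidistribution-at t₀∈ N≡ φ≤1 vanishes r q refl even = equidistribution t₀∈ N≡ φ≤1 vanishes r q even

suc-pred-pos : ∀ {n} → 0 < n → n ≡ suc (pred n)
suc-pred-pos {suc n} _ = refl

-- The quotient of `H` by `asymp` is x / y, so the two inequalities say that it differs from 1 by
-- less than 1/k when k is positive.
hurwitz-estimate : ∀ μ → All (0 <_) μ → 2 ≤ sum μ → ∀ k → ∃[ G ] (∀ g → G ≤ g →
  let x = autSize μ * product μ * hurwitzCount g μ; y = 2 * (sum μ C 2) ^ numBranch g μ in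
  k * x < k * y + y × k * y < k * x + y)
-- There are at least g steps, so this threshold yields both at least Q full blocks of length 2d and
-- at least Q′ steps: the former controls the oscillation, the latter the intransitive tuples.
hurwitz-estimate μ ps 2≤d k = Q * (d * 2) + Q′ , estimate
  where
  d = sum μ
  X = autSize μ * product μ
  S = ∑ (codes d) (inClass μ)
  N = length (transpositions d)
  instance
    d*2≢0 : NonZero (d * 2)
    d*2≢0 = >-nonZero (≤-trans (s≤s z≤n) (≤-trans 2≤d (m≤m*n d 2)))
    S≢0 : NonZero S
    S≢0 = m*n≢0⇒m≢0 S {{>-nonZero (subst (0 <_) (sym (∑-inClass ps (≤-trans (s≤s z≤n) 2≤d))) (1≤n! d))}}
  t₀∈ = proj₂ (transposition-exists 2≤d)
  0<N : 0 < N
  0<N = ≤-trans (s≤s z≤n) (∑-differs t₀∈)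
  0<N^ : ∀ m → 0 < N ^ m
  0<N^ m = m^n>0 N {{>-nonZero 0<N}} m
  n = pred N
  a = pred (N ^ (d * 2))
  N≡ : N ≡ suc n
  N≡ = suc-pred-pos 0<N
  N^≡ : N ^ (d * 2) ≡ suc a
  N^≡ = suc-pred-pos (0<N^ (d * 2))
  K = 2 * k * X
  Q = proj₁ (geometric-decay a K)
  Q′ = proj₁ (geometric-decay n (K * pred d))
  estimate : ∀ g → Q * (d * 2) + Q′ ≤ g →
             let x = X * hurwitzCount g μ; y = 2 * (d C 2) ^ numBranch g μ in
             k * x < k * y + y × k * y < k * x + y
  estimate g G≤g = subst
    (λ N → k * x < k * (2 * N ^ m) + 2 * N ^ m × k * (2 * N ^ m) < k * x + 2 * N ^ m)
    (length-transpositions d)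
    (squeeze k (∑-inClass ps (≤-trans (s≤s z≤n) 2≤d)) (0<N^ m) (proj₁ equi) (proj₂ equi)
      (hurwitzCount-≤ g μ) (hurwitzCount-≥ g μ (suc-pred-pos (≤-trans (s≤s z≤n) 2≤d)) N≡) δ-small r-small)
    where
    open ≤-Reasoning
    x = X * hurwitzCount g μ
    m = numBranch g μ
    q = m / (d * 2)
    r = m % (d * 2)
    m≡ : m ≡ r + q * (d * 2)
    m≡ = m≡m%n+[m/n]*n m (d * 2)
    g≤m : g ≤ m
    g≤m = begin
      g                                   ≤⟨ m≤m+n g _ ⟩
      g + (d ∸ 2 + g + length μ)          ≡⟨ rearrange g (d ∸ 2) (length μ) ⟩
      d ∸ 2 + 2 * g + length μ            ≡⟨ cong (_+ length μ) (+-∸-comm (2 * g) 2≤d) ⟨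
      (d + 2 * g ∸ 2) + length μ          ≡⟨ +-∸-comm (length μ) (≤-trans 2≤d (m≤m+n d _)) ⟨
      m                                   ∎
      where
      rearrange : ∀ g e n → g + (e + g + n) ≡ e + 2 * g + n
      rearrange = solve-∀
    G≤m : Q * (d * 2) + Q′ ≤ m
    G≤m = ≤-trans G≤g g≤m
    equi = equidistribution-at t₀∈ N^≡ {φ = inClass μ} (λ c → 𝟙≤1 (hasCycleType (eval c) μ)) (inClass-vanishesOff ps)
             r q m≡ (numBranch-parity g {μ} 2≤d)
    Q≤q : Q ≤ q
    Q≤q = subst (_≤ q) (m*n/n≡m Q (d * 2)) (/-monoˡ-≤ (d * 2) (≤-trans (m≤m+n _ Q′) G≤m))
    δ-small : K * (a ^ q * N ^ r) ≤ N ^ m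
    δ-small = begin
      K * (a ^ q * N ^ r)              ≡⟨ *-assoc K (a ^ q) (N ^ r) ⟨
      K * a ^ q * N ^ r                ≤⟨ *-monoˡ-≤ (N ^ r) (proj₂ (geometric-decay a K) q Q≤q) ⟩
      suc a ^ q * N ^ r                ≡⟨ cong (λ b → b ^ q * N ^ r) N^≡ ⟨
      (N ^ (d * 2)) ^ q * N ^ r        ≡⟨ cong (_* N ^ r) (^-*-assoc N (d * 2) q) ⟩
      N ^ (d * 2 * q) * N ^ r          ≡⟨ ^-distribˡ-+-* N (d * 2 * q) r ⟨
      N ^ (d * 2 * q + r)              ≡⟨ cong (N ^_) (trans (+-comm _ r) (cong (_+_ r) (*-comm (d * 2) q))) ⟩
      N ^ (r + q * (d * 2))            ≡⟨ cong (N ^_) m≡ ⟨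
      N ^ m                            ∎
    r-small : K * (pred d * n ^ m) ≤ N ^ m
    r-small = begin
      K * (pred d * n ^ m)             ≡⟨ *-assoc K (pred d) (n ^ m) ⟨
      K * pred d * n ^ m               ≤⟨ proj₂ (geometric-decay n (K * pred d)) m (≤-trans (m≤n+m Q′ _) G≤m) ⟩
      suc n ^ m                        ≡⟨ cong (_^ m) N≡ ⟨
      N ^ m                            ∎

-- From inequalities of natural numbers to rationals.

fraction-difference-< : ∀ u₁ u₂ y s₁ s₂ t .{{_ : NonZero s₁}} .{{_ : NonZero s₂}} .{{_ : NonZero t}} p k →
  u₁ * s₂ * (k * t) < u₂ * s₁ * (k * t) + p * y * (s₁ * s₂) → .{{_ : NonZero k}} →
  (ℤ.+ u₁) ℚᵘ./ s₁ ℚᵘ.- (ℤ.+ u₂) ℚᵘ./ s₂ ℚᵘ.< ((ℤ.+ p) ℚᵘ./ k) ℚᵘ.* ((ℤ.+ y) ℚᵘ./ t)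
fraction-difference-< u₁ u₂ y s₁@(suc _) s₂@(suc _) t@(suc _) p k@(suc _) lt = *<* (begin-strict
  (ℤ.+ u₁ ℤ.* ℤ.+ s₂ ℤ.+ ℤ.- (ℤ.+ u₂) ℤ.* ℤ.+ s₁) ℤ.* ℤ.+ (k * t)
    ≡⟨ cong (λ z → (ℤ.+ u₁ ℤ.* ℤ.+ s₂ ℤ.+ ℤ.- (ℤ.+ u₂) ℤ.* ℤ.+ s₁) ℤ.* z) (ℤ.pos-* k t) ⟩
  (ℤ.+ u₁ ℤ.* ℤ.+ s₂ ℤ.+ ℤ.- (ℤ.+ u₂) ℤ.* ℤ.+ s₁) ℤ.* (ℤ.+ k ℤ.* ℤ.+ t)
    ≡⟨ expand (ℤ.+ u₁) (ℤ.+ u₂) (ℤ.+ s₁) (ℤ.+ s₂) (ℤ.+ k ℤ.* ℤ.+ t) ⟩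
  ℤ.+ u₁ ℤ.* ℤ.+ s₂ ℤ.* (ℤ.+ k ℤ.* ℤ.+ t) ℤ.- ℤ.+ u₂ ℤ.* ℤ.+ s₁ ℤ.* (ℤ.+ k ℤ.* ℤ.+ t)
    ≡⟨ cong₂ (λ v w → v ℤ.- w) (product-ℤ u₁ s₂ k t) (product-ℤ u₂ s₁ k t) ⟩
  ℤ.+ (u₁ * s₂ * (k * t)) ℤ.- ℤ.+ (u₂ * s₁ * (k * t))
    <⟨ ℤ.+-monoˡ-< (ℤ.- ℤ.+ (u₂ * s₁ * (k * t))) (+<+ lt) ⟩
  ℤ.+ (u₂ * s₁ * (k * t)) ℤ.+ ℤ.+ (p * y * (s₁ * s₂)) ℤ.- ℤ.+ (u₂ * s₁ * (k * t))
    ≡⟨ cancel (ℤ.+ (u₂ * s₁ * (k * t))) (ℤ.+ (p * y * (s₁ * s₂))) ⟩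
  ℤ.+ (p * y * (s₁ * s₂))
    ≡⟨ trans (ℤ.pos-* (p * y) (s₁ * s₂)) (cong (λ z → z ℤ.* ℤ.+ (s₁ * s₂)) (ℤ.pos-* p y)) ⟩
  ℤ.+ p ℤ.* ℤ.+ y ℤ.* ℤ.+ (s₁ * s₂) ∎)
  where
  open ℤ.≤-Reasoning
  expand : ∀ a b s t e → (a ℤ.* t ℤ.+ ℤ.- b ℤ.* s) ℤ.* e ≡ a ℤ.* t ℤ.* e ℤ.- b ℤ.* s ℤ.* e
  expand = ℤ-Solver.solve-∀
  cancel : ∀ a b → a ℤ.+ b ℤ.- a ≡ b
  cancel = ℤ-Solver.solve-∀
  product-ℤ : ∀ a b c e → ℤ.+ a ℤ.* ℤ.+ b ℤ.* (ℤ.+ c ℤ.* ℤ.+ e) ≡ ℤ.+ (a * b * (c * e))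
  product-ℤ a b c e = sym (trans (ℤ.pos-* (a * b) (c * e)) (cong₂ ℤ._*_ (ℤ.pos-* a b) (ℤ.pos-* c e)))

toℚᵘ-/ : ∀ u s .{{_ : NonZero s}} → toℚᵘ ((ℤ.+ u) /ℚ s) ℚᵘ.≃ (ℤ.+ u) ℚᵘ./ s
toℚᵘ-/ u (suc s) = ℚ.toℚᵘ-fromℚᵘ (mkℚᵘ (ℤ.+ u) s)

-- A positive `ε` has numerator at least 1, so it is at least the reciprocal of its denominator; the
-- hypothesis is the cross-multiplied bound for that reciprocal.
difference-< : ∀ u₁ u₂ y s₁ s₂ t .{{_ : NonZero s₁}} .{{_ : NonZero s₂}} .{{_ : NonZero t}} ε → 0ℚ <ℚ ε →
  u₁ * s₂ * (↧ₙ ε * t) < u₂ * s₁ * (↧ₙ ε * t) + y * (s₁ * s₂) →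
  ((ℤ.+ u₁) /ℚ s₁ - (ℤ.+ u₂) /ℚ s₂) <ℚ ε *ℚ ((ℤ.+ y) /ℚ t)
difference-< u₁ u₂ y s₁ s₂ t (mkℚ (ℤ.+ zero) k-1 _) (*<*ℚ (+<+ ()))
difference-< u₁ u₂ y s₁ s₂ t ε@(mkℚ (ℤ.+ suc p) k-1 _) 0<ε lt = ℚ.toℚᵘ-cancel-<
  (ℚᵘ.<-respˡ-≃ (ℚᵘ.≃-sym left) (ℚᵘ.<-respʳ-≃ (ℚᵘ.≃-sym right)
    (fraction-difference-< u₁ u₂ y s₁ s₂ t (suc p) (suc k-1)
      (<-≤-trans lt (+-monoʳ-≤ (u₂ * s₁ * (suc k-1 * t)) (*-monoˡ-≤ (s₁ * s₂) (m≤n*m y (suc p))))))))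
  where
  left : toℚᵘ ((ℤ.+ u₁) /ℚ s₁ - (ℤ.+ u₂) /ℚ s₂) ℚᵘ.≃ (ℤ.+ u₁) ℚᵘ./ s₁ ℚᵘ.- (ℤ.+ u₂) ℚᵘ./ s₂
  left = ℚᵘ.≃-trans (ℚ.toℚᵘ-homo-+ ((ℤ.+ u₁) /ℚ s₁) (-ℚ ((ℤ.+ u₂) /ℚ s₂)))
    (ℚᵘ.+-cong (toℚᵘ-/ u₁ s₁) (ℚᵘ.≃-trans (ℚ.toℚᵘ-homo‿- ((ℤ.+ u₂) /ℚ s₂)) (ℚᵘ.-‿cong (toℚᵘ-/ u₂ s₂))))
  right : toℚᵘ (ε *ℚ ((ℤ.+ y) /ℚ t)) ℚᵘ.≃ ((ℤ.+ suc p) ℚᵘ./ suc k-1) ℚᵘ.* ((ℤ.+ y) ℚᵘ./ t)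
  right = ℚᵘ.≃-trans (ℚ.toℚᵘ-homo-* ε ((ℤ.+ y) /ℚ t)) (ℚᵘ.*-cong (ℚᵘ.≃-refl {toℚᵘ ε}) (toℚᵘ-/ y t))

∣p-q∣<r : ∀ p q {r} → (p - q) <ℚ r → (q - p) <ℚ r → ∣ p - q ∣ <ℚ r
∣p-q∣<r p q {r} p-q<r q-p<r with ℚ.∣p∣≡p∨∣p∣≡-p (p - q)
... | inj₁ eq = subst (_<ℚ r) (sym eq) p-q<r
... | inj₂ eq = subst (_<ℚ r) (sym (trans eq (⁻¹-anti-homo‿- ℚ.+-0-abelianGroup p q))) q-p<r

theorem1p6 : (μ : List ℕ) (pos : All (0 <_) μ) → 2 ≤ sum μ →
    (ε : ℚ) → 0ℚ <ℚ ε →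
    ∃[ G ] ((g : ℕ) → G ≤ g →
    ∣ H g μ - asymp g μ pos ∣ <ℚ ε *ℚ asymp g μ pos)
theorem1p6 μ ps 2≤d ε 0<ε = G , λ g G≤g → close g (estimate g G≤g)
  where
  k = ↧ₙ ε
  G = proj₁ (hurwitz-estimate μ ps 2≤d k)
  estimate = proj₂ (hurwitz-estimate μ ps 2≤d k)
  d! = sum μ !
  Π = product μ
  aut = autSize μ
  instance
    d!≢0 : NonZero d!
    d!≢0 = sum μ !≢0
    d!Π≢0 : NonZero (d! * Π)
    d!Π≢0 = m*n≢0 d! Π {{d!≢0}} {{prodPos μ ps}}
  close : ∀ g → let x = aut * Π * hurwitzCount g μ; y = 2 * (sum μ C 2) ^ numBranch g μ in
          k * x < k * y + y × k * y < k * x + y → ∣ H g μ - asymp g μ ps ∣ <ℚ ε *ℚ asymp g μ ps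
  close g (above , below) = ∣p-q∣<r (H g μ) (asymp g μ ps)
    (difference-< (aut * h) y y d! (d! * Π) (d! * Π) ε 0<ε
      (subst₂ _<_ (x-side d! Π aut h k) (above-side d! Π k y) (scale above)))
    (difference-< y (aut * h) y (d! * Π) d! (d! * Π) ε 0<ε
      (subst₂ _<_ (y-side d! Π k y) (below-side d! Π aut h k y) (scale below)))
    where
    h = hurwitzCount g μ
    y = 2 * (sum μ C 2) ^ numBranch g μ
    -- This factor is the product of the denominators of `H` and `asymp`; with it both estimates
    -- become the cross-multiplied form that `difference-<` expects.
    scale : ∀ {u v} → u < v → d! * (d! * Π) * u < d! * (d! * Π) * v
    scale = *-monoʳ-< (d! * (d! * Π)) {{m*n≢0 d! (d! * Π)}}
    x-side : ∀ d π a h k → d * (d * π) * (k * (a * π * h)) ≡ a * h * (d * π) * (k * (d * π))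
    x-side = solve-∀
    above-side : ∀ d π k y → d * (d * π) * (k * y + y) ≡ y * d * (k * (d * π)) + y * (d * (d * π))
    above-side = solve-∀
    y-side : ∀ d π k y → d * (d * π) * (k * y) ≡ y * d * (k * (d * π))
    y-side = solve-∀
    below-side : ∀ d π a h k y →
      d * (d * π) * (k * (a * π * h) + y) ≡ a * h * (d * π) * (k * (d * π)) + y * (d * π * d)
    below-side = solve-∀
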